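{- Let $G$ be a triangle-free subdivision of $K_4$. Then $G$ is a restricted frame graph if and only if either (1) $G$ is obtained from $K_4$ by subdividing at most $3$ of its $6$ edges, or (2) $G$ is obtained from $K_4$ by subdividing exactly $4$ of its edges and the two non-subdivided edges share a vertex.
   Context: A subdivision of $K_4$ is obtained by replacing each edge of $K_4$ by a path; an edge is subdivided if its path has at least $2$ edges (each subdivided edge may be subdivided any number $\ge 1$ of times). A frame is the boundary of an axis-parallel box $[a,b]\times[c,d]\subset\mathbb R^2$ ($a<b$, $c<d$). A graph $G$ is a restricted frame graph if there is a family $\{F_v : v\in V(G)\}$ of frames such that for distinct $u,v$, $uv\in E(G)$ iff $F_u\cap F_v\neq\emptyset$, and: (1) no corner of a frame lies on another frame; (2) the left side of any frame does not intersect any other frame; (3) if the right side of a frame intersects a second frame, this right side intersects both the top and bottom sides of the second frame; (4) if two frames intersect, then no frame is entirely contained in the intersection of the closed regions bounded by the two frames.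
   Formalization: The frames are taken to have rational rather than real corner coordinates; since only the relative order of finitely many coordinates matters, this yields the same class of restricted frame graphs. -}

module Defs where

open import Level using (0ℓ)
open import Data.Nat as ℕ using (ℕ; zero; suc)
open import Data.Fin using (Fin; zero; suc; toℕ)
open import Data.Fin.Properties using (_≟_)
open import Data.List using (List; length; filter)
open import Data.List.Base using ()
open import Data.Fin.Base using ()
open import Data.List using (List)
open import Data.Product using (Σ; ∃; _×_; _,_)
open import Data.Sum using (_⊎_; inj₁; inj₂)
open import Data.Rational using (ℚ; _≤_; _<_)
open import Relation.Binary.PropositionalEquality using (_≡_; _≢_)
open import Relation.Nullary using (¬_)
open import Function.Bundles using (_⤖_; Bijection; _⇔_)
import Data.List.Base as L

record Graph : Set₁ where
  field
    V     : Set
    Adj   : V → V → Set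
    sym   : ∀ {u v} → Adj u v → Adj v u
    irrfl : ∀ {v} → ¬ Adj v v

open Graph public

TriangleFree : Graph → Set
TriangleFree G =
  ¬ (Σ (V G) λ a → Σ (V G) λ b → Σ (V G) λ c →
       Adj G a b × Adj G b c × Adj G a c)

-- K4 on Fin 4, its 6 edges indexed by Fin 6 with endpoints src < tgt.

src tgt : Fin 6 → Fin 4
src zero = zero
src (suc zero) = zero
src (suc (suc zero)) = zero
src (suc (suc (suc zero))) = suc zero
src (suc (suc (suc (suc zero)))) = suc zero
src (suc (suc (suc (suc (suc zero))))) = suc (suc zero)
tgt zero = suc zero
tgt (suc zero) = suc (suc zero)
tgt (suc (suc zero)) = suc (suc (suc zero))
tgt (suc (suc (suc zero))) = suc (suc zero)
tgt (suc (suc (suc (suc zero)))) = suc (suc (suc zero))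
tgt (suc (suc (suc (suc (suc zero))))) = suc (suc (suc zero))

-- The subdivision of K4 in which edge e is replaced by a path with
-- len e internal vertices (len e + 1 edges).  Vertices: the 4 branch
-- vertices, and the internal vertices (e , k), k = 0 .. len e - 1,
-- ordered from src e to tgt e.
SubV : (Fin 6 → ℕ) → Set
SubV len = Fin 4 ⊎ Σ (Fin 6) (λ e → Fin (len e))

data SubArc (len : Fin 6 → ℕ) : SubV len → SubV len → Set where
  direct : ∀ e → len e ≡ 0 → SubArc len (inj₁ (src e)) (inj₁ (tgt e))
  first  : ∀ e (k : Fin (len e)) → toℕ k ≡ 0 →
           SubArc len (inj₁ (src e)) (inj₂ (e , k))
  last   : ∀ e (k : Fin (len e)) → suc (toℕ k) ≡ len e →
           SubArc len (inj₂ (e , k)) (inj₁ (tgt e))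
  step   : ∀ e (k k′ : Fin (len e)) → suc (toℕ k) ≡ toℕ k′ →
           SubArc len (inj₂ (e , k)) (inj₂ (e , k′))

SubAdj : (len : Fin 6 → ℕ) → SubV len → SubV len → Set
SubAdj len x y = SubArc len x y ⊎ SubArc len y x

IsSubdivisionOfK4 : Graph → (Fin 6 → ℕ) → Set
IsSubdivisionOfK4 G len =
  Σ (SubV len ⤖ V G) λ f →
    ∀ x y → Adj G (Bijection.to f x) (Bijection.to f y) ⇔ SubAdj len x y

Subdivided : (Fin 6 → ℕ) → Fin 6 → Set
Subdivided len e = 1 ℕ.≤ len e

numSubdivided : (Fin 6 → ℕ) → ℕ
numSubdivided len = length (filter (λ e → 1 ℕ.≤? len e) (L.allFin 6))

ShareVertex : Fin 6 → Fin 6 → Set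
ShareVertex e e′ =
  src e ≡ src e′ ⊎ src e ≡ tgt e′ ⊎ tgt e ≡ src e′ ⊎ tgt e ≡ tgt e′

-- Frames: boundaries of axis-parallel boxes [a,b]×[c,d], a<b, c<d.
-- Coordinates are taken in ℚ.

Point : Set
Point = ℚ × ℚ

record Frame : Set where
  field
    a b c d : ℚ
    a<b : a < b
    c<d : c < d

open Frame public

PointSet : Set₁
PointSet = Point → Set

LeftSide RightSide TopSide BottomSide : Frame → PointSet
LeftSide   F (x , y) = x ≡ a F × c F ≤ y × y ≤ d F
RightSide  F (x , y) = x ≡ b F × c F ≤ y × y ≤ d F
TopSide    F (x , y) = y ≡ d F × a F ≤ x × x ≤ b F
BottomSide F (x , y) = y ≡ c F × a F ≤ x × x ≤ b F

OnFrame : Frame → PointSet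
OnFrame F p = LeftSide F p ⊎ RightSide F p ⊎ TopSide F p ⊎ BottomSide F p

Region : Frame → PointSet
Region F (x , y) = (a F ≤ x × x ≤ b F) × (c F ≤ y × y ≤ d F)

Corner : Frame → PointSet
Corner F (x , y) = (x ≡ a F ⊎ x ≡ b F) × (y ≡ c F ⊎ y ≡ d F)

Meets : PointSet → PointSet → Set
Meets S T = Σ Point λ p → S p × T p

_⊆ₚ_ : PointSet → PointSet → Set
S ⊆ₚ T = ∀ p → S p → T p

record RestrictedFrameRep (G : Graph) : Set₁ where
  field
    F : V G → Frame
    adj⇔meet : ∀ u v → u ≢ v → Adj G u v ⇔ Meets (OnFrame (F u)) (OnFrame (F v))
    cond1 : ∀ u v → u ≢ v → ¬ Meets (Corner (F u)) (OnFrame (F v))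
    cond2 : ∀ u v → u ≢ v → ¬ Meets (LeftSide (F u)) (OnFrame (F v))
    cond3 : ∀ u v → u ≢ v → Meets (RightSide (F u)) (OnFrame (F v)) →
            Meets (RightSide (F u)) (TopSide (F v)) ×
            Meets (RightSide (F u)) (BottomSide (F v))
    cond4 : ∀ u v → u ≢ v → Meets (OnFrame (F u)) (OnFrame (F v)) →
            ∀ w → ¬ (OnFrame (F w) ⊆ₚ (λ p → Region (F u) p × Region (F v) p))

IsRestrictedFrameGraph : Graph → Set₁
IsRestrictedFrameGraph G = RestrictedFrameRep G

{-# OPTIONS --safe #-}

-- The condition says that two unsubdivided edges of K₄ share a vertex.
--
-- Two frames of a representation are either adjacent, in which case one sticks out of the other
-- through its right side, or nested, or disjoint. If u contains some frame, the neighbours of u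
-- separate the frames inside u from the others, so if the graph has no star cutset, then u
-- contains all its non-neighbours. On any cycle, the vertex with the rightmost left side is
-- crossed by both its neighbours, which are therefore nested. A cycle missing u thus produces a
-- second frame v containing all its non-neighbours. Then u and v are adjacent, and by condition
-- (4) nothing lies in both, so uv is a dominating edge. When the unsubdivided edges form a
-- matching there is neither a star cutset nor a dominating edge.
--
-- When the edges 01 and 02 are unsubdivided, triangle-freeness forces 12 to be subdivided, and
-- also 13 and 23 if 03 is not. An explicit family of frames exists in each of the two cases.
module Submission where

open import Defs
open import Data.Bool.Base using (Bool; true; false; if_then_else_)
open import Data.Bool.Properties using (T?) renaming (_≟_ to _≟ᵇ_)
open import Data.Empty using (⊥; ⊥-elim)
open import Data.Fin.Base using (Fin; zero; suc; toℕ; fromℕ; fromℕ<; inject₁; cast; opposite)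
open import Data.Fin.Patterns
open import Data.Fin.Permutation as Perm
  using (Permutation′; _⟨$⟩ʳ_; _⟨$⟩ˡ_; inverseˡ; transpose; _∘ₚ_)
open import Data.Fin.Properties
  using (toℕ-injective; toℕ<n; toℕ-fromℕ<; toℕ-fromℕ; toℕ-inject₁; toℕ-cast; cast-is-id;
         opposite-prop; opposite-involutive; all?; any?)
  renaming (_≟_ to _≟ᶠ_)
open import Data.Fin.Relation.Unary.Top using (view; ‵fromℕ; ‵inject₁)
import Data.Integer.Base as ℤ
import Data.Integer.Properties as ℤ
open import Data.List.Base
  using (List; []; _∷_; _++_; length; map; concatMap; filter; allFin)
import Data.List.Extrema as Extrema
open import Data.List.Membership.Propositional using (_∈_)
open import Data.List.Membership.Propositional.Properties
  using (∈-++⁺ˡ; ∈-++⁺ʳ; ∈-map⁺; ∈-concatMap⁺; ∈-filter⁺; ∈-allFin)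
open import Data.List.Relation.Unary.All using (lookup)
open import Data.List.Relation.Unary.All.Properties using (all-filter)
import Data.List.Relation.Unary.Any as Any
open import Data.Nat.Base as ℕ using (ℕ; zero; suc; z≤n; s≤s; _+_; _*_; _∸_; _≤_; _<_; _≤ᵇ_)
import Data.Nat.Coprimality as Coprimality
import Data.Nat.Properties as ℕ
open import Data.Product using (Σ; _×_; _,_; proj₁; proj₂)
open import Data.Rational as ℚ using (ℚ; mkℚ)
import Data.Rational.Properties as ℚ
open import Data.Sum using (_⊎_; inj₁; inj₂; [_,_]′; swap)
open import Data.Sum.Properties using (inj₁-injective)
open import Function using (_∘_; id; case_of_)
open import Function.Bundles using (_⇔_; mk⇔; Equivalence; Bijection)
open import Relation.Binary.Bundles using (DecTotalOrder)
open import Relation.Binary.Definitions using (tri<; tri≈; tri>)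
open import Relation.Binary.PropositionalEquality
  using (_≡_; _≢_; refl; cong; cong₂; subst; trans; ≢-sym) renaming (sym to ≡-sym)
open import Relation.Nullary using (¬_; Dec; yes; no; does)
open import Relation.Nullary.Decidable
  using (from-yes; _×-dec_; _⊎-dec_; _→-dec_; ¬?; map′; ¬¬-excluded-middle)
open import Relation.Nullary.Negation using (contradiction)
open import Relation.Unary using (Decidable)

open Extrema (DecTotalOrder.totalOrder ℚ.≤-decTotalOrder)
  using (argmax; argmax-all; f[xs]≤f[argmax])

-- The matching hypothesis has two uses. Deleting a branch vertex `i` and its neighbours destroys at
-- most one further branch vertex, so a path off `i` keeps an end through which it can be left; with
-- two unsubdivided edges at `i` both ends could be lost. And an edge can only dominate if the two
-- branch vertices off its path are attached to it by unsubdivided edges, which makes two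
-- unsubdivided edges meet. In the constructions, nested frames are never adjacent, so 0 and 3 can
-- both be tall and nested only when 03 is subdivided. Otherwise 3 moves into a strip, the last
-- vertex of the path from 2 to 3 replaces it, and the edge 01 becomes a crossing of two tall
-- frames, one of which contains nothing, as condition (4) demands.

-- Crossing, nested and disjoint pairs of frames

-- The only way in which two frames of a restricted family can meet: G sticks out of F through
-- the right side of F.
record Crosses (F G : Frame) : Set where
  constructor crosses
  field
    a<a : a F ℚ.< a G
    enters : a G ℚ.< b F
    b<b : b F ℚ.< b G
    c<c : c F ℚ.< c G
    d<d : d G ℚ.< d F

record Inside (F G : Frame) : Set where
  constructor inside
  field
    a>a : a G ℚ.< a F
    b<b : b F ℚ.< b G
    c>c : c G ℚ.< c F
    d<d : d F ℚ.< d G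

Disjoint : Frame → Frame → Set
Disjoint F G = b F ℚ.< a G ⊎ b G ℚ.< a F ⊎ d F ℚ.< c G ⊎ d G ℚ.< c F

Apart : Frame → Frame → Set
Apart F G = Inside F G ⊎ Inside G F ⊎ Disjoint F G

Meet : Frame → Frame → Set
Meet F G = Meets (OnFrame F) (OnFrame G)

lt⇒¬ge : ∀ {x y : ℚ} → x ℚ.< y → ¬ y ℚ.≤ x
lt⇒¬ge x<y y≤x = ℚ.<-irrefl refl (ℚ.<-≤-trans x<y y≤x)

≤∧≢⇒< : ∀ {x y : ℚ} → x ℚ.≤ y → x ≢ y → x ℚ.< y
≤∧≢⇒< {x} {y} x≤y x≢y with ℚ.<-cmp x y
... | tri< x<y _ _ = x<y
... | tri≈ _ x≡y _ = contradiction x≡y x≢y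
... | tri> _ _ y<x = contradiction x≤y (lt⇒¬ge y<x)

a≤b : ∀ F → a F ℚ.≤ b F
a≤b F = ℚ.<⇒≤ (Frame.a<b F)

c≤d : ∀ F → c F ℚ.≤ d F
c≤d F = ℚ.<⇒≤ (Frame.c<d F)

OnFrame⊆Region : ∀ F → OnFrame F ⊆ₚ Region F
OnFrame⊆Region F p (inj₁ (refl , y)) = (ℚ.≤-refl , a≤b F) , y
OnFrame⊆Region F p (inj₂ (inj₁ (refl , y))) = (a≤b F , ℚ.≤-refl) , y
OnFrame⊆Region F p (inj₂ (inj₂ (inj₁ (refl , x)))) = x , (c≤d F , ℚ.≤-refl)
OnFrame⊆Region F p (inj₂ (inj₂ (inj₂ (refl , x)))) = x , (ℚ.≤-refl , c≤d F)

Corner⊆OnFrame : ∀ F → Corner F ⊆ₚ OnFrame F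
Corner⊆OnFrame F p (inj₁ refl , inj₁ refl) = inj₁ (refl , ℚ.≤-refl , c≤d F)
Corner⊆OnFrame F p (inj₁ refl , inj₂ refl) = inj₁ (refl , c≤d F , ℚ.≤-refl)
Corner⊆OnFrame F p (inj₂ refl , inj₁ refl) = inj₂ (inj₁ (refl , ℚ.≤-refl , c≤d F))
Corner⊆OnFrame F p (inj₂ refl , inj₂ refl) = inj₂ (inj₁ (refl , c≤d F , ℚ.≤-refl))

swap-Meets : ∀ {S T : PointSet} → Meets S T → Meets T S
swap-Meets (p , s , t) = p , t , s

Crosses⇒RightMeets : ∀ {F G} → Crosses F G →
  Meets (RightSide F) (TopSide G) × Meets (RightSide F) (BottomSide G)
Crosses⇒RightMeets {F} {G} (crosses _ a<b b<b c<c d<d) =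
  ((b F , d G) , (refl , ℚ.≤-trans (ℚ.<⇒≤ c<c) (c≤d G) , ℚ.<⇒≤ d<d)
               , (refl , ℚ.<⇒≤ a<b , ℚ.<⇒≤ b<b)) ,
  ((b F , c G) , (refl , ℚ.<⇒≤ c<c , ℚ.≤-trans (c≤d G) (ℚ.<⇒≤ d<d))
               , (refl , ℚ.<⇒≤ a<b , ℚ.<⇒≤ b<b))

Crosses⇒Meet : ∀ {F G} → Crosses F G → Meet F G
Crosses⇒Meet F→G with (p , on-F , on-G) , _ ← Crosses⇒RightMeets F→G =
  p , inj₂ (inj₁ on-F) , inj₂ (inj₂ (inj₁ on-G))

Inside⇒¬Meet : ∀ {F G} → Inside F G → ¬ Meet F G
Inside⇒¬Meet {F} {G} (inside a>a b<b c>c d<d) (p , on-F , on-G)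
  with (a≤x , x≤b) , (c≤y , y≤d) ← OnFrame⊆Region F p on-F | on-G
... | inj₁ (x≡a , _) = lt⇒¬ge a>a (ℚ.≤-trans a≤x (ℚ.≤-reflexive x≡a))
... | inj₂ (inj₁ (x≡b , _)) = lt⇒¬ge b<b (ℚ.≤-trans (ℚ.≤-reflexive (≡-sym x≡b)) x≤b)
... | inj₂ (inj₂ (inj₁ (y≡d , _))) = lt⇒¬ge d<d (ℚ.≤-trans (ℚ.≤-reflexive (≡-sym y≡d)) y≤d)
... | inj₂ (inj₂ (inj₂ (y≡c , _))) = lt⇒¬ge c>c (ℚ.≤-trans c≤y (ℚ.≤-reflexive y≡c))

Disjoint⇒¬Meets : ∀ {F G} → Disjoint F G → ¬ Meets (Region F) (Region G)
Disjoint⇒¬Meets dis (p , ((a≤x , x≤b) , (c≤y , y≤d)) , ((a≤x′ , x≤b′) , (c≤y′ , y≤d′))) with dis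
... | inj₁ b<a = lt⇒¬ge b<a (ℚ.≤-trans a≤x′ x≤b)
... | inj₂ (inj₁ b<a) = lt⇒¬ge b<a (ℚ.≤-trans a≤x x≤b′)
... | inj₂ (inj₂ (inj₁ d<c)) = lt⇒¬ge d<c (ℚ.≤-trans c≤y′ y≤d)
... | inj₂ (inj₂ (inj₂ d<c)) = lt⇒¬ge d<c (ℚ.≤-trans c≤y y≤d′)

Apart⇒¬Meet : ∀ {F G} → Apart F G → ¬ Meet F G
Apart⇒¬Meet (inj₁ F⊂G) = Inside⇒¬Meet F⊂G
Apart⇒¬Meet (inj₂ (inj₁ G⊂F)) = Inside⇒¬Meet G⊂F ∘ swap-Meets
Apart⇒¬Meet {F} {G} (inj₂ (inj₂ dis)) (p , on-F , on-G) =
  Disjoint⇒¬Meets {F} {G} dis (p , OnFrame⊆Region F p on-F , OnFrame⊆Region G p on-G)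

module _ {F G : Frame} (F→G : Crosses F G) where
  open Crosses F→G

  cornerˡ : ¬ Meets (Corner F) (OnFrame G)
  cornerˡ (p , (_ , y) , on-G) with _ , (c≤y , y≤d) ← OnFrame⊆Region G p on-G | y
  ... | inj₁ refl = lt⇒¬ge c<c c≤y
  ... | inj₂ refl = lt⇒¬ge d<d y≤d

  leftˡ : ¬ Meets (LeftSide F) (OnFrame G)
  leftˡ (p , (refl , _) , on-G) = lt⇒¬ge a<a (proj₁ (proj₁ (OnFrame⊆Region G p on-G)))

  cornerʳ : ¬ Meets (Corner G) (OnFrame F)
  cornerʳ (p , (x , y) , on-F) with x | y | on-F
  ... | inj₁ refl | _ | inj₁ (a≡a , _) = ℚ.<-irrefl (≡-sym a≡a) a<a
  ... | inj₁ refl | _ | inj₂ (inj₁ (a≡b , _)) = ℚ.<-irrefl a≡b enters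
  ... | inj₂ refl | _ | inj₁ (b≡a , _) =
    ℚ.<-irrefl (≡-sym b≡a) (ℚ.<-trans (ℚ.<-trans a<a enters) b<b)
  ... | inj₂ refl | _ | inj₂ (inj₁ (b≡b , _)) = ℚ.<-irrefl (≡-sym b≡b) b<b
  ... | _ | inj₁ refl | inj₂ (inj₂ (inj₁ (c≡d , _))) =
    ℚ.<-irrefl c≡d (ℚ.<-trans (Frame.c<d G) d<d)
  ... | _ | inj₁ refl | inj₂ (inj₂ (inj₂ (c≡c , _))) = ℚ.<-irrefl (≡-sym c≡c) c<c
  ... | _ | inj₂ refl | inj₂ (inj₂ (inj₁ (d≡d , _))) = ℚ.<-irrefl d≡d d<d
  ... | _ | inj₂ refl | inj₂ (inj₂ (inj₂ (d≡c , _))) =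
    ℚ.<-irrefl (≡-sym d≡c) (ℚ.<-trans c<c (Frame.c<d G))

  leftʳ : ¬ Meets (LeftSide G) (OnFrame F)
  leftʳ (p , (refl , c≤y , y≤d) , on-F) with on-F
  ... | inj₁ (a≡a , _) = ℚ.<-irrefl (≡-sym a≡a) a<a
  ... | inj₂ (inj₁ (a≡b , _)) = ℚ.<-irrefl a≡b enters
  ... | inj₂ (inj₂ (inj₁ (refl , _))) = lt⇒¬ge d<d y≤d
  ... | inj₂ (inj₂ (inj₂ (refl , _))) = lt⇒¬ge c<c c≤y

  -- Condition (3) is therefore vacuous for the crossed frame: its right side lies beyond all of
  -- `F`.
  rightʳ : ¬ Meets (RightSide G) (OnFrame F)
  rightʳ (p , (refl , _) , on-F) = lt⇒¬ge b<b (proj₂ (proj₁ (OnFrame⊆Region F p on-F)))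

-- From positions of frames to a representation

-- Replaces the conditions on point sets by order relations between coordinates, against which a
-- concrete family can be checked.
record Layout (G : Graph) : Set where
  field
    frame : V G → Frame
    layout : ∀ {u v} → u ≢ v →
      (Adj G u v × (Crosses (frame u) (frame v) ⊎ Crosses (frame v) (frame u))) ⊎
      (¬ Adj G u v × Apart (frame u) (frame v))
    no-common : ∀ {u v w} → Crosses (frame u) (frame v) →
      Inside (frame w) (frame u) → ¬ Inside (frame w) (frame v)

Region-⊆ : ∀ {F G} → OnFrame F ⊆ₚ Region G →
  (a G ℚ.≤ a F × b F ℚ.≤ b G) × (c G ℚ.≤ c F × d F ℚ.≤ d G)
Region-⊆ {F} F⊆G
  with (a≤a , _) , (c≤c , _) ← F⊆G (a F , c F) (Corner⊆OnFrame F _ (inj₁ refl , inj₁ refl))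
     | (_ , b≤b) , (_ , d≤d) ← F⊆G (b F , d F) (Corner⊆OnFrame F _ (inj₂ refl , inj₂ refl))
  = (a≤a , b≤b) , (c≤c , d≤d)

module _ {G : Graph} (L : Layout G) (_≟_ : ∀ (u v : V G) → u ≡ v ⊎ u ≢ v) where
  open Layout L

  Adj⇔Meet : ∀ u v → u ≢ v → Adj G u v ⇔ Meet (frame u) (frame v)
  Adj⇔Meet u v u≢v with layout u≢v
  ... | inj₁ (u~v , inj₁ u→v) = mk⇔ (λ _ → Crosses⇒Meet u→v) (λ _ → u~v)
  ... | inj₁ (u~v , inj₂ v→u) = mk⇔ (λ _ → swap-Meets (Crosses⇒Meet v→u)) (λ _ → u~v)
  ... | inj₂ (u≁v , u∥v) = mk⇔ (⊥-elim ∘ u≁v) (⊥-elim ∘ Apart⇒¬Meet u∥v)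

  Meet⇒Crosses : ∀ {u v} → u ≢ v → Meet (frame u) (frame v) →
    Crosses (frame u) (frame v) ⊎ Crosses (frame v) (frame u)
  Meet⇒Crosses u≢v meet with layout u≢v
  ... | inj₁ (_ , c) = c
  ... | inj₂ (_ , u∥v) = contradiction meet (Apart⇒¬Meet u∥v)

  ⊆Region⇒Inside : ∀ {w u} → w ≢ u → OnFrame (frame w) ⊆ₚ Region (frame u) →
    Inside (frame w) (frame u)
  ⊆Region⇒Inside {w} {u} w≢u w⊆u with Region-⊆ {frame w} {frame u} w⊆u | layout w≢u
  ... | (a≤a , b≤b) , _ | inj₁ (_ , inj₁ w→u) = contradiction a≤a (lt⇒¬ge (Crosses.a<a w→u))
  ... | (a≤a , b≤b) , _ | inj₁ (_ , inj₂ u→w) = contradiction b≤b (lt⇒¬ge (Crosses.b<b u→w))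
  ... | _ | inj₂ (_ , inj₁ w⊂u) = w⊂u
  ... | (a≤a , b≤b) , _ | inj₂ (_ , inj₂ (inj₁ u⊂w)) =
    contradiction a≤a (lt⇒¬ge (Inside.a>a u⊂w))
  ... | _ | inj₂ (_ , inj₂ (inj₂ dis)) = contradiction
    (_ , OnFrame⊆Region (frame w) _ corner , w⊆u _ corner)
    (Disjoint⇒¬Meets {frame w} {frame u} dis)
    where corner = Corner⊆OnFrame (frame w) _ (inj₁ refl , inj₁ refl)

  -- Condition (4) ranges over every `w`, so `u` and `v` themselves have to be ruled out first:
  -- neither of two crossing frames lies in the region of the other.
  no-common′ : ∀ {u v} → Crosses (frame u) (frame v) → ∀ w →
    OnFrame (frame w) ⊆ₚ Region (frame u) → ¬ (OnFrame (frame w) ⊆ₚ Region (frame v))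
  no-common′ {u} {v} u→v w w⊆u w⊆v with w ≟ u | w ≟ v
  ... | inj₁ refl | _ =
    lt⇒¬ge (Crosses.a<a u→v) (proj₁ (proj₁ (Region-⊆ {frame u} {frame v} w⊆v)))
  ... | _ | inj₁ refl =
    lt⇒¬ge (Crosses.b<b u→v) (proj₂ (proj₁ (Region-⊆ {frame v} {frame u} w⊆u)))
  ... | inj₂ w≢u | inj₂ w≢v =
    no-common u→v (⊆Region⇒Inside w≢u w⊆u) (⊆Region⇒Inside w≢v w⊆v)

  Layout⇒Rep : RestrictedFrameRep G
  Layout⇒Rep = record
    { F = frame
    ; adj⇔meet = Adj⇔Meet
    ; cond1 = λ u v u≢v meet@(p , corner , on) →
        [ (λ u→v → cornerˡ u→v meet) , (λ v→u → cornerʳ v→u meet) ]′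
        (Meet⇒Crosses u≢v (p , Corner⊆OnFrame (frame u) p corner , on))
    ; cond2 = λ u v u≢v meet@(p , left , on) →
        [ (λ u→v → leftˡ u→v meet) , (λ v→u → leftʳ v→u meet) ]′
        (Meet⇒Crosses u≢v (p , inj₁ left , on))
    ; cond3 = λ u v u≢v meet@(p , right , on) →
        [ Crosses⇒RightMeets , (λ v→u → contradiction meet (rightʳ v→u)) ]′
        (Meet⇒Crosses u≢v (p , inj₂ (inj₁ right) , on))
    ; cond4 = λ u v u≢v meet w w⊆ →
        [ (λ u→v → no-common′ u→v w (λ p → proj₁ ∘ w⊆ p) (λ p → proj₂ ∘ w⊆ p))
        , (λ v→u → no-common′ v→u w (λ p → proj₂ ∘ w⊆ p) (λ p → proj₁ ∘ w⊆ p)) ]′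
        (Meet⇒Crosses u≢v meet)
    }

-- Pairs of frames subject to conditions (1) to (3)

record Admissible (F G : Frame) : Set where
  field
    corner : ¬ Meets (Corner F) (OnFrame G)
    left : ¬ Meets (LeftSide F) (OnFrame G)
    right : Meets (RightSide F) (OnFrame G) →
      Meets (RightSide F) (TopSide G) × Meets (RightSide F) (BottomSide G)

module _ {F G : Frame} (F! : Admissible F G) (G! : Admissible G F) where
  private
    module F = Admissible F!
    module G = Admissible G!

  -- Condition (3) puts the right side of `F` across the top and the bottom of `G`, which gives all
  -- inequalities but the first in weak form. Equality would put a corner on the other frame. If `F`
  -- did not start left of `G`, its left side would meet the top of `G`.
  Right⇒Crosses : Meets (RightSide F) (OnFrame G) → Crosses F G
  Right⇒Crosses meet with F.right meet
  ... | ((_ , _) , (refl , c≤d , d≤d) , (refl , a≤b′ , b≤b)) ,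
        ((_ , _) , (refl , c≤c , c≤d′) , (refl , _)) =
    crosses
      (ℚ.≰⇒> λ a≤a → F.left ((a F , d G) , (refl , c≤d , d≤d)
                              , inj₂ (inj₂ (inj₁ (refl , a≤a , ℚ.≤-trans (a≤b F) b≤b)))))
      (≤∧≢⇒< a≤b′ λ a≡b → G.corner ((a G , d G) , (inj₁ refl , inj₂ refl)
                                   , inj₂ (inj₁ (a≡b , c≤d , d≤d))))
      (≤∧≢⇒< b≤b λ b≡b → G.corner ((b G , d G) , (inj₂ refl , inj₂ refl)
                                  , inj₂ (inj₁ (≡-sym b≡b , c≤d , d≤d))))
      (≤∧≢⇒< c≤c λ c≡c → F.corner ((b F , c F) , (inj₂ refl , inj₁ refl)
                                  , inj₂ (inj₂ (inj₂ (c≡c , a≤b′ , b≤b)))))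
      (≤∧≢⇒< d≤d λ d≡d → F.corner ((b F , d F) , (inj₂ refl , inj₂ refl)
                                  , inj₂ (inj₂ (inj₁ (≡-sym d≡d , a≤b′ , b≤b)))))

Horizontal : Frame → PointSet
Horizontal F (x , y) = (y ≡ c F ⊎ y ≡ d F) × a F ℚ.≤ x × x ℚ.≤ b F

Horizontal⊆OnFrame : ∀ F → Horizontal F ⊆ₚ OnFrame F
Horizontal⊆OnFrame F p (inj₁ y≡c , x) = inj₂ (inj₂ (inj₂ (y≡c , x)))
Horizontal⊆OnFrame F p (inj₂ y≡d , x) = inj₂ (inj₂ (inj₁ (y≡d , x)))

module _ {F G : Frame} (F! : Admissible F G) (G! : Admissible G F) where

  -- Of two overlapping horizontal sides on one line, one starts within the other, and its left end
  -- is a corner.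
  ¬HorizontalMeets : ¬ Meets (Horizontal F) (Horizontal G)
  ¬HorizontalMeets ((x , y) , (y∈F , a≤x , x≤b) , (y∈G , a≤x′ , x≤b′)) with ℚ.≤-total (a F) (a G)
  ... | inj₁ a≤a = Admissible.corner G! ((a G , y) , (inj₁ refl , y∈G)
      , Horizontal⊆OnFrame F _ (y∈F , a≤a , ℚ.≤-trans a≤x′ x≤b))
  ... | inj₂ a≤a = Admissible.corner F! ((a F , y) , (inj₁ refl , y∈F)
      , Horizontal⊆OnFrame G _ (y∈G , a≤a , ℚ.≤-trans a≤x x≤b′))

  Meet⇒Crosses-admissible : Meet F G → Crosses F G ⊎ Crosses G F
  Meet⇒Crosses-admissible (p , on-F , on-G) with on-F | on-G
  ... | inj₁ l | _ = contradiction (p , l , on-G) (Admissible.left F!)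
  ... | inj₂ (inj₁ r) | _ = inj₁ (Right⇒Crosses F! G! (p , r , on-G))
  ... | _ | inj₁ l = contradiction (p , l , on-F) (Admissible.left G!)
  ... | _ | inj₂ (inj₁ r) = inj₂ (Right⇒Crosses G! F! (p , r , on-F))
  ... | inj₂ (inj₂ h) | inj₂ (inj₂ h′) =
    contradiction (p , horizontal F h , horizontal G h′) ¬HorizontalMeets
    where
    horizontal : ∀ H → TopSide H p ⊎ BottomSide H p → Horizontal H p
    horizontal H (inj₁ (y≡d , x)) = inj₂ y≡d , x
    horizontal H (inj₂ (y≡c , x)) = inj₁ y≡c , x

-- The left side of `G` starts within the horizontal range of `F` and touches neither its top nor
-- its bottom, so it stays strictly between them. Then the bottom of `G` cannot reach the right side
-- of `F`.
overlap⇒Inside : ∀ {F G} → ¬ Meet F G → a F ℚ.< a G → a G ℚ.≤ b F →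
  c G ℚ.≤ d F → c F ℚ.≤ d G → Inside G F
overlap⇒Inside {F} {G} ¬meet a<a a≤b′ cG≤dF cF≤dG = inside a<a b<b c<c d<d
  where
  c<c = ℚ.≰⇒> λ cG≤cF → ¬meet ((a G , c F) , inj₂ (inj₂ (inj₂ (refl , ℚ.<⇒≤ a<a , a≤b′)))
                                , inj₁ (refl , cG≤cF , cF≤dG))
  d<d = ℚ.≰⇒> λ dF≤dG → ¬meet ((a G , d F) , inj₂ (inj₂ (inj₁ (refl , ℚ.<⇒≤ a<a , a≤b′)))
                                , inj₁ (refl , cG≤dF , dF≤dG))
  b<b = ℚ.≰⇒> λ bF≤bG → ¬meet ((b F , c G) , inj₂ (inj₁ (refl , ℚ.<⇒≤ c<c , cG≤dF))
                                , inj₂ (inj₂ (inj₂ (refl , a≤b′ , bF≤bG))))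

¬Meet⇒Apart : ∀ {F G} → ¬ Meet F G → Apart F G
¬Meet⇒Apart {F} {G} ¬meet
  with b F ℚ.<? a G | b G ℚ.<? a F | d F ℚ.<? c G | d G ℚ.<? c F
... | yes b<a | _ | _ | _ = inj₂ (inj₂ (inj₁ b<a))
... | _ | yes b<a | _ | _ = inj₂ (inj₂ (inj₂ (inj₁ b<a)))
... | _ | _ | yes d<c | _ = inj₂ (inj₂ (inj₂ (inj₂ (inj₁ d<c))))
... | _ | _ | _ | yes d<c = inj₂ (inj₂ (inj₂ (inj₂ (inj₂ d<c))))
... | no bF≮aG | no bG≮aF | no dF≮cG | no dG≮cF with ℚ.<-cmp (a F) (a G)
...   | tri< a<a _ _ = inj₂ (inj₁ (overlap⇒Inside ¬meet a<a
          (ℚ.≮⇒≥ bF≮aG) (ℚ.≮⇒≥ dF≮cG) (ℚ.≮⇒≥ dG≮cF)))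
...   | tri> _ _ a<a = inj₁ (overlap⇒Inside (¬meet ∘ swap-Meets) a<a
          (ℚ.≮⇒≥ bG≮aF) (ℚ.≮⇒≥ dG≮cF) (ℚ.≮⇒≥ dF≮cG))
-- With equal left ends, the higher of the two lower left corners lies on both left sides.
...   | tri≈ _ a≡a _ with ℚ.≤-total (c F) (c G)
...     | inj₁ c≤c = contradiction
          ((a F , c G) , inj₁ (refl , c≤c , ℚ.≮⇒≥ dF≮cG)
                       , inj₁ (a≡a , ℚ.≤-refl , c≤d G)) ¬meet
...     | inj₂ c≤c = contradiction
          ((a F , c F) , inj₁ (refl , ℚ.≤-refl , c≤d F)
                       , inj₁ (a≡a , c≤c , ℚ.≮⇒≥ dG≮cF)) ¬meet

Inside-trans : ∀ {F G H} → Inside F G → Inside G H → Inside F H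
Inside-trans (inside a b c d) (inside a′ b′ c′ d′) =
  inside (ℚ.<-trans a′ a) (ℚ.<-trans b b′) (ℚ.<-trans c′ c) (ℚ.<-trans d d′)

Inside-asym : ∀ {F G} → Inside F G → ¬ Inside G F
Inside-asym F⊂G G⊂F = ℚ.<-asym (Inside.b<b F⊂G) (Inside.b<b G⊂F)

Inside⇒⊆Region : ∀ {F G} → Inside F G → OnFrame F ⊆ₚ Region G
Inside⇒⊆Region {F} (inside a>a b<b c>c d<d) p on-F
  with (a≤x , x≤b) , (c≤y , y≤d) ← OnFrame⊆Region F p on-F =
  (ℚ.≤-trans (ℚ.<⇒≤ a>a) a≤x , ℚ.≤-trans x≤b (ℚ.<⇒≤ b<b)) ,
  (ℚ.≤-trans (ℚ.<⇒≤ c>c) c≤y , ℚ.≤-trans y≤d (ℚ.<⇒≤ d<d))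

-- The point (a H , c H) lies in the regions of F and of G.
common-Crosses⇒¬Disjoint : ∀ {F G H} → Crosses F H → Crosses G H → ¬ Disjoint F G
common-Crosses⇒¬Disjoint {F} {G} {H} F→H G→H dis =
  Disjoint⇒¬Meets {F} {G} dis ((a H , c H) , in-region F→H , in-region G→H)
  where
  in-region : ∀ {K} → Crosses K H → Region K (a H , c H)
  in-region (crosses a<a enters b<b c<c d<d) =
    (ℚ.<⇒≤ a<a , ℚ.<⇒≤ enters) ,
    (ℚ.<⇒≤ c<c , ℚ.<⇒≤ (ℚ.<-trans (Frame.c<d H) d<d))

-- Graph properties that exclude a representation

Avoids : (G : Graph) → V G → V G → Set
Avoids G u t = t ≢ u × ¬ Adj G t u

-- Connectedness of the graph without the closed neighbourhood of `u`, phrased for properties that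
-- spread along edges, so that no paths have to be handled.
NoStarCutset : Graph → Set₁
NoStarCutset G = ∀ u (P : V G → Set) →
  (∀ {s t} → Avoids G u s → Avoids G u t → Adj G s t → P s → P t) →
  ∀ {s t} → Avoids G u s → Avoids G u t → P s → P t

-- All that is used of a cycle missing `u`: whatever the function on the vertices, the cycle has a
-- vertex whose two neighbours on it are no higher.
HasPeaks : Graph → Set
HasPeaks G = ∀ u (f : V G → ℚ) → Σ (V G) λ x → Σ (V G) λ i → Σ (V G) λ j →
  i ≢ u × j ≢ u × i ≢ j × Adj G x i × Adj G x j × f i ℚ.≤ f x × f j ℚ.≤ f x

NoDominatingEdge : Graph → Set
NoDominatingEdge G = ∀ {u v} → Adj G u v →
  ¬ (∀ y → ¬ (Avoids G u y × Avoids G v y))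

module _ {G : Graph} (R : RestrictedFrameRep G) where
  open RestrictedFrameRep R

  Adj⇒≢ : ∀ {u v} → Adj G u v → u ≢ v
  Adj⇒≢ u~v refl = irrfl G u~v

  admissible : ∀ {u v} → u ≢ v → Admissible (F u) (F v)
  admissible u≢v = record
    { corner = cond1 _ _ u≢v ; left = cond2 _ _ u≢v ; right = cond3 _ _ u≢v }

  Adj⇒Crosses : ∀ {u v} → Adj G u v → Crosses (F u) (F v) ⊎ Crosses (F v) (F u)
  Adj⇒Crosses u~v = Meet⇒Crosses-admissible (admissible (Adj⇒≢ u~v))
    (admissible (≢-sym (Adj⇒≢ u~v))) (Equivalence.to (adj⇔meet _ _ (Adj⇒≢ u~v)) u~v)

  ¬Adj⇒Apart : ∀ {u v} → u ≢ v → ¬ Adj G u v → Apart (F u) (F v)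
  ¬Adj⇒Apart u≢v u≁v = ¬Meet⇒Apart (u≁v ∘ Equivalence.from (adj⇔meet _ _ u≢v))

  no-common-Inside : ∀ {u v w} → Adj G u v → Inside (F w) (F u) → ¬ Inside (F w) (F v)
  no-common-Inside u~v w⊂u w⊂v = cond4 _ _ (Adj⇒≢ u~v)
    (Equivalence.to (adj⇔meet _ _ (Adj⇒≢ u~v)) u~v) _
    λ p on → Inside⇒⊆Region w⊂u p on , Inside⇒⊆Region w⊂v p on

  -- The frame of `t` meets one inside `u`, so it is not disjoint from `u`; nor does it contain `u`,
  -- as `s` would then lie strictly inside `t`. Being apart from `u`, it lies inside.
  Inside-spreads : ∀ {u s t} → Avoids G u t → Adj G s t → Inside (F s) (F u) → Inside (F t) (F u)
  Inside-spreads {u} {s} {t} (t≢u , t≁u) s~t s⊂u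
    with meet@(p , on-s , on-t) ← Equivalence.to (adj⇔meet _ _ (Adj⇒≢ s~t)) s~t
       | ¬Adj⇒Apart t≢u t≁u
  ... | inj₁ t⊂u = t⊂u
  ... | inj₂ (inj₁ u⊂t) = contradiction meet (Inside⇒¬Meet (Inside-trans s⊂u u⊂t))
  ... | inj₂ (inj₂ dis) = contradiction
    (p , OnFrame⊆Region (F t) p on-t , Inside⇒⊆Region s⊂u p on-s)
    (Disjoint⇒¬Meets {F t} {F u} dis)

  common-Crosses⇒Inside : ∀ {i j x} → i ≢ j → ¬ Adj G i j →
    Crosses (F i) (F x) → Crosses (F j) (F x) → Inside (F i) (F j) ⊎ Inside (F j) (F i)
  common-Crosses⇒Inside i≢j i≁j i→x j→x with ¬Adj⇒Apart i≢j i≁j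
  ... | inj₁ i⊂j = inj₁ i⊂j
  ... | inj₂ (inj₁ j⊂i) = inj₂ j⊂i
  ... | inj₂ (inj₂ dis) = contradiction dis (common-Crosses⇒¬Disjoint i→x j→x)

  module _ (tf : TriangleFree G) (no-star-cutset : NoStarCutset G) (peaks : HasPeaks G)
           (no-dominating-edge : NoDominatingEdge G) where

    Inside-everything : ∀ {w u} → Inside (F w) (F u) → ∀ {t} → Avoids G u t → Inside (F t) (F u)
    Inside-everything {w} {u} w⊂u t-avoids = no-star-cutset u (λ t → Inside (F t) (F u))
      (λ _ t-avoids s~t → Inside-spreads t-avoids s~t)
      ((λ { refl → Inside-asym w⊂u w⊂u })
      , λ w~u → Inside⇒¬Meet w⊂u (Equivalence.to (adj⇔meet _ _ (Adj⇒≢ w~u)) w~u))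
      t-avoids w⊂u

    -- At a vertex x where the left end is maximal along a cycle missing u, both neighbours
    -- on the cycle cross x, so one is inside the other.
    nested-pair : ∀ u → Σ (V G) λ i → Σ (V G) λ j → j ≢ u × Inside (F i) (F j)
    nested-pair u with peaks u (a ∘ F)
    ... | x , i , j , i≢u , j≢u , i≢j , x~i , x~j , i≤x , j≤x
      with common-Crosses⇒Inside i≢j (λ i~j → tf (x , i , j , x~i , i~j , x~j))
             (below x~i i≤x) (below x~j j≤x)
      where
      below : ∀ {y} → Adj G x y → a (F y) ℚ.≤ a (F x) → Crosses (F y) (F x)
      below x~y y≤x with Adj⇒Crosses x~y
      ... | inj₁ x→y = contradiction y≤x (lt⇒¬ge (Crosses.a<a x→y))
      ... | inj₂ y→x = y→x
    ... | inj₁ i⊂j = i , j , j≢u , i⊂j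
    ... | inj₂ j⊂i = j , i , i≢u , j⊂i

    -- Two distinct frames that contain something contain all vertices they avoid; being
    -- adjacent, they would dominate the graph.
    not-representable : V G → ⊥
    not-representable v₀ with nested-pair v₀
    ... | w , u , _ , w⊂u with nested-pair u
    -- Adjacency in an arbitrary graph is not decidable, but the goal is empty. If `u` and `j` are
    -- not adjacent, each lies inside the other.
    ...   | i , j , j≢u , i⊂j = ¬¬-excluded-middle λ where
      (no u≁j) → Inside-asym
        (Inside-everything w⊂u (j≢u , u≁j ∘ sym G))
        (Inside-everything i⊂j (≢-sym j≢u , u≁j))
      (yes u~j) → no-dominating-edge u~j λ y (y≁u , y≁v) →
        no-common-Inside u~j (Inside-everything w⊂u y≁u) (Inside-everything i⊂j y≁v)

-- Incidences in K₄ and adjacency in its subdivisions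

Joins : Fin 6 → Fin 4 → Fin 4 → Set
Joins e i j = (src e ≡ i × tgt e ≡ j) ⊎ (src e ≡ j × tgt e ≡ i)

joins? : ∀ e i j → Dec (Joins e i j)
joins? e i j = (src e ≟ᶠ i ×-dec tgt e ≟ᶠ j) ⊎-dec (src e ≟ᶠ j ×-dec tgt e ≟ᶠ i)

-- Junk value on the diagonal.
link : Fin 4 → Fin 4 → Fin 6
link 0F 1F = 0F
link 1F 0F = 0F
link 0F 2F = 1F
link 2F 0F = 1F
link 0F 3F = 2F
link 3F 0F = 2F
link 1F 2F = 3F
link 2F 1F = 3F
link 1F 3F = 4F
link 3F 1F = 4F
link 2F 3F = 5F
link 3F 2F = 5F
link _ _ = 0F

abstract
  link-joins : ∀ i j → i ≢ j → Joins (link i j) i j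
  link-joins = from-yes (all? λ i → all? λ j → ¬? (i ≟ᶠ j) →-dec joins? (link i j) i j)

  joins-link : ∀ e i j → Joins e i j → link i j ≡ e
  joins-link = from-yes (all? λ e → all? λ i → all? λ j → joins? e i j →-dec link i j ≟ᶠ e)

  src≢tgt : ∀ e → src e ≢ tgt e
  src≢tgt = from-yes (all? λ e → ¬? (src e ≟ᶠ tgt e))

shareVertex? : ∀ e e′ → Dec (ShareVertex e e′)
shareVertex? e e′ =
  src e ≟ᶠ src e′ ⊎-dec src e ≟ᶠ tgt e′ ⊎-dec tgt e ≟ᶠ src e′ ⊎-dec tgt e ≟ᶠ tgt e′

abstract
  links-share : ∀ i j k → i ≢ j → k ≢ j → i ≢ k →
    link i j ≢ link j k × ShareVertex (link i j) (link j k)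
  links-share = from-yes (all? λ i → all? λ j → all? λ k →
    ¬? (i ≟ᶠ j) →-dec ¬? (k ≟ᶠ j) →-dec ¬? (i ≟ᶠ k) →-dec
    ¬? (link i j ≟ᶠ link j k) ×-dec shareVertex? (link i j) (link j k))

_∈ᵉ_ : Fin 4 → Fin 6 → Set
i ∈ᵉ e = src e ≡ i ⊎ tgt e ≡ i

_∈ᵉ?_ : ∀ i e → Dec (i ∈ᵉ e)
i ∈ᵉ? e = src e ≟ᶠ i ⊎-dec tgt e ≟ᶠ i

abstract
  -- The two vertices are the ends of the opposite edge.
  two-off : ∀ e → Σ (Fin 4) λ i → Σ (Fin 4) λ j → i ≢ j × ¬ i ∈ᵉ e × ¬ j ∈ᵉ e
  two-off = from-yes (all? λ e → any? λ i → any? λ j →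
    ¬? (i ≟ᶠ j) ×-dec ¬? (i ∈ᵉ? e) ×-dec ¬? (j ∈ᵉ? e))

  -- For `i ≢ t` these are the other two corners of the triangle missing `t`; the case `i ≡ t`
  -- serves to find some vertex other than `t`.
  two-others : ∀ i t → Σ (Fin 4) λ p → Σ (Fin 4) λ q →
    p ≢ i × q ≢ i × p ≢ t × q ≢ t × p ≢ q × link i p ≢ link i q
  two-others = from-yes (all? λ i → all? λ t → any? λ p → any? λ q →
    ¬? (p ≟ᶠ i) ×-dec ¬? (q ≟ᶠ i) ×-dec ¬? (p ≟ᶠ t) ×-dec ¬? (q ≟ᶠ t) ×-dec
    ¬? (p ≟ᶠ q) ×-dec ¬? (link i p ≟ᶠ link i q))

  end-off : ∀ e e′ → e ≢ e′ → ¬ src e ∈ᵉ e′ ⊎ ¬ tgt e ∈ᵉ e′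
  end-off = from-yes (all? λ e → all? λ e′ →
    ¬? (e ≟ᶠ e′) →-dec (¬? (src e ∈ᵉ? e′) ⊎-dec ¬? (tgt e ∈ᵉ? e′)))

∈ᵉ-joins : ∀ {e i j} → Joins e i j → i ∈ᵉ e × j ∈ᵉ e
∈ᵉ-joins (inj₁ (s , t)) = inj₁ s , inj₂ t
∈ᵉ-joins (inj₂ (s , t)) = inj₂ t , inj₁ s

first-or-empty : ∀ n → n ≡ 0 ⊎ Σ (Fin n) λ k → toℕ k ≡ 0
first-or-empty zero = inj₁ refl
first-or-empty (suc n) = inj₂ (zero , refl)

last-or-empty : ∀ n → n ≡ 0 ⊎ Σ (Fin n) λ k → suc (toℕ k) ≡ n
last-or-empty zero = inj₁ refl
last-or-empty (suc n) = inj₂ (fromℕ n , cong suc (toℕ-fromℕ n))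

pred-or-zero : ∀ {n} (k : Fin n) → toℕ k ≡ 0 ⊎ Σ (Fin n) λ j → suc (toℕ j) ≡ toℕ k
pred-or-zero zero = inj₁ refl
pred-or-zero (suc k) = inj₂ (inject₁ k , cong suc (toℕ-inject₁ k))

suc-or-last : ∀ {n} (k : Fin n) → suc (toℕ k) ≡ n ⊎ Σ (Fin n) λ j → suc (toℕ k) ≡ toℕ j
suc-or-last {n} k with suc (toℕ k) ℕ.≟ n
... | yes eq = inj₁ eq
... | no ≢n = inj₂ (fromℕ< 1+k<n , ≡-sym (toℕ-fromℕ< 1+k<n))
  where 1+k<n = ℕ.≤∧≢⇒< (toℕ<n k) ≢n

AtEnd : (len : Fin 6 → ℕ) → Fin 4 → (e : Fin 6) → Fin (len e) → Set
AtEnd len i e k = (src e ≡ i × toℕ k ≡ 0) ⊎ (tgt e ≡ i × suc (toℕ k) ≡ len e)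

module _ {len : Fin 6 → ℕ} where

  arc-irrefl : ∀ {x} → ¬ SubArc len x x
  arc-irrefl x→x = irrefl x→x refl
    where
    irrefl : ∀ {x y} → SubArc len x y → x ≢ y
    irrefl (direct e _) eq = src≢tgt e (inj₁-injective eq)
    irrefl (step e k k′ k<k′) refl = ℕ.1+n≢n k<k′

  adj-irrefl : ∀ {x} → ¬ SubAdj len x x
  adj-irrefl = [ arc-irrefl , arc-irrefl ]′

  arc-branch-branch : ∀ {i j} → SubArc len (inj₁ i) (inj₁ j) → i ≢ j × len (link i j) ≡ 0
  arc-branch-branch (direct e p) =
    src≢tgt e , trans (cong len (joins-link e _ _ (inj₁ (refl , refl)))) p

  arc-branch-branch′ : ∀ {i j} → SubArc len (inj₁ j) (inj₁ i) → i ≢ j × len (link i j) ≡ 0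
  arc-branch-branch′ (direct e p) =
    ≢-sym (src≢tgt e) , trans (cong len (joins-link e _ _ (inj₂ (refl , refl)))) p

  adj-branch-branch : ∀ {i j} → SubAdj len (inj₁ i) (inj₁ j) → i ≢ j × len (link i j) ≡ 0
  adj-branch-branch = [ arc-branch-branch , arc-branch-branch′ ]′

  adj-branch-inner : ∀ {i e k} → SubAdj len (inj₁ i) (inj₂ (e , k)) → AtEnd len i e k
  adj-branch-inner (inj₁ (first e k p)) = inj₁ (refl , p)
  adj-branch-inner (inj₂ (last e k p)) = inj₂ (refl , p)

  adj-inner-inner : ∀ {e k e′ k′} → SubAdj len (inj₂ (e , k)) (inj₂ (e′ , k′)) →
    e ≡ e′ × (suc (toℕ k) ≡ toℕ k′ ⊎ suc (toℕ k′) ≡ toℕ k)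
  adj-inner-inner (inj₁ (step e k k′ p)) = refl , inj₁ p
  adj-inner-inner (inj₂ (step e k k′ p)) = refl , inj₂ p

Sub : (Fin 6 → ℕ) → Graph
Sub len = record { V = SubV len ; Adj = SubAdj len ; sym = swap ; irrfl = adj-irrefl }

inner-injective : ∀ {len : Fin 6 → ℕ} {e k k′} →
  _≡_ {A = SubV len} (inj₂ (e , k)) (inj₂ (e , k′)) → k ≡ k′
inner-injective refl = refl

-- Connectedness after removal of a closed neighbourhood

module _ (len : Fin 6 → ℕ) where

  Clear : SubV len → Fin 6 → Set
  Clear u e = ∀ k → Avoids (Sub len) u (inj₂ (e , k))

  module Walk (u : SubV len) (P : SubV len → Set)
    (spread : ∀ {s t} → Avoids (Sub len) u s → Avoids (Sub len) u t → SubAdj len s t → P s → P t)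
    where

    -- Plays the part of "joined by a path of free vertices": each piece of a path transports `P` in
    -- both directions.
    _~_ : SubV len → SubV len → Set
    s ~ t = (P s → P t) × (P t → P s)

    ~-refl : ∀ {s} → s ~ s
    ~-refl = id , id

    ~-sym : ∀ {s t} → s ~ t → t ~ s
    ~-sym (f , g) = g , f

    ~-trans : ∀ {r s t} → r ~ s → s ~ t → r ~ t
    ~-trans (f , g) (f′ , g′) = f′ ∘ f , g ∘ g′

    Free : SubV len → Set
    Free = Avoids (Sub len) u

    edge : ∀ {s t} → Free s → Free t → SubArc len s t → s ~ t
    edge s! t! s→t = spread s! t! (inj₁ s→t) , spread t! s! (inj₂ s→t)

    -- The position is carried separately as `n`, so that the recursion can descend while `k` stays
    -- in `Fin (len e)`. Freeness is asked only between `k` and the end, since removed vertices may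
    -- lie beyond `k`.
    to-src : ∀ e n (k : Fin (len e)) → toℕ k ≡ n → Free (inj₁ (src e)) →
      (∀ k′ → toℕ k′ ℕ.≤ toℕ k → Free (inj₂ (e , k′))) → inj₂ (e , k) ~ inj₁ (src e)
    to-src e zero k k≡n s! free = ~-sym (edge s! (free k ℕ.≤-refl) (first e k k≡n))
    to-src e (suc n) k k≡n s! free =
      ~-trans (~-sym (edge (free j j≤k) (free k ℕ.≤-refl)
          (step e j k (trans (cong suc j≡n) (≡-sym k≡n)))))
        (to-src e n j j≡n s! λ k′ k′≤j → free k′ (ℕ.≤-trans k′≤j j≤k))
      where
      n<len = ℕ.≤-trans (ℕ.≤-reflexive (≡-sym k≡n)) (ℕ.<⇒≤ (toℕ<n k))
      j = fromℕ< n<len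
      j≡n = toℕ-fromℕ< n<len
      j≤k = ℕ.≤-trans (ℕ.≤-reflexive j≡n) (ℕ.≤-trans (ℕ.n≤1+n n) (ℕ.≤-reflexive (≡-sym k≡n)))

    to-tgt : ∀ e n (k : Fin (len e)) → n ℕ.+ suc (toℕ k) ≡ len e → Free (inj₁ (tgt e)) →
      (∀ k′ → toℕ k ℕ.≤ toℕ k′ → Free (inj₂ (e , k′))) → inj₂ (e , k) ~ inj₁ (tgt e)
    to-tgt e zero k k≡n t! free = edge (free k ℕ.≤-refl) t! (last e k k≡n)
    to-tgt e (suc n) k k≡n t! free =
      ~-trans (edge (free k ℕ.≤-refl) (free j k≤j) (step e k j (≡-sym j≡k)))
        (to-tgt e n j (trans (cong (λ m → n ℕ.+ suc m) j≡k) (trans (ℕ.+-suc n _) k≡n)) t!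
          λ k′ j≤k′ → free k′ (ℕ.≤-trans k≤j j≤k′))
      where
      k<len : suc (toℕ k) ℕ.< len e
      k<len = ℕ.≤-trans (s≤s (ℕ.m≤n+m _ n)) (ℕ.≤-reflexive k≡n)
      j = fromℕ< k<len
      j≡k = toℕ-fromℕ< k<len
      k≤j = ℕ.≤-trans (ℕ.n≤1+n _) (ℕ.≤-reflexive (≡-sym j≡k))

    to-src′ : ∀ e k → Free (inj₁ (src e)) →
      (∀ k′ → toℕ k′ ℕ.≤ toℕ k → Free (inj₂ (e , k′))) → inj₂ (e , k) ~ inj₁ (src e)
    to-src′ e k = to-src e (toℕ k) k refl

    to-tgt′ : ∀ e k → Free (inj₁ (tgt e)) →
      (∀ k′ → toℕ k ℕ.≤ toℕ k′ → Free (inj₂ (e , k′))) → inj₂ (e , k) ~ inj₁ (tgt e)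
    to-tgt′ e k = to-tgt e (len e ℕ.∸ suc (toℕ k)) k (ℕ.m∸n+n≡m (toℕ<n k))

    across : ∀ e → Clear u e → Free (inj₁ (src e)) → Free (inj₁ (tgt e)) →
      inj₁ (src e) ~ inj₁ (tgt e)
    across e clear s! t! with first-or-empty (len e)
    ... | inj₁ eq = edge s! t! (direct e eq)
    ... | inj₂ (k , _) = ~-trans (~-sym (to-src′ e k s! λ k′ _ → clear k′))
                                 (to-tgt′ e k t! λ k′ _ → clear k′)

    across-joins : ∀ {e i j} → Joins e i j → Clear u e → Free (inj₁ i) → Free (inj₁ j) →
      inj₁ i ~ inj₁ j
    across-joins (inj₁ (refl , refl)) clear i! j! = across _ clear i! j!
    across-joins (inj₂ (refl , refl)) clear i! j! = ~-sym (across _ clear j! i!)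

module _ {len : Fin 6 → ℕ}
  (matching : ∀ {e e′} → e ≢ e′ → len e ≡ 0 → len e′ ≡ 0 → ¬ ShareVertex e e′) where

  no-flat-path : ∀ {i j k} → i ≢ j → k ≢ j → i ≢ k →
    len (link i j) ≡ 0 → ¬ len (link j k) ≡ 0
  no-flat-path {i} {j} {k} i≢j k≢j i≢k p q with distinct , share ← links-share i j k i≢j k≢j i≢k =
    matching distinct p q share

  link-sym : ∀ i j → len (link i j) ≡ len (link j i)
  link-sym i j with i ≟ᶠ j
  ... | yes refl = refl
  ... | no i≢j = cong len (≡-sym (joins-link _ _ _ (swap (link-joins i j i≢j))))

  module AwayFromBranch (i : Fin 4) (P : SubV len → Set)
    (spread : ∀ {s t} → Avoids (Sub len) (inj₁ i) s → Avoids (Sub len) (inj₁ i) t →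
      SubAdj len s t → P s → P t) where
    open Walk len (inj₁ i) P spread

    inner-free : ∀ {e k} → ¬ AtEnd len i e k → Free (inj₂ (e , k))
    inner-free ¬end = (λ ()) , ¬end ∘ adj-branch-inner ∘ swap

    clear : ∀ e → ¬ i ∈ᵉ e → Clear len (inj₁ i) e
    clear e i∉e k = inner-free [ i∉e ∘ inj₁ ∘ proj₁ , i∉e ∘ inj₂ ∘ proj₁ ]′

    branch-free : ∀ {j} → j ≢ i → len (link j i) ≢ 0 → Free (inj₁ j)
    branch-free j≢i ≢0 = (λ { refl → j≢i refl }) , ≢0 ∘ proj₂ ∘ adj-branch-branch

    -- The edge of K₄ between two branch vertices other than `i` misses `i`, so no inner vertex of
    -- its path is removed.
    branches : ∀ {j j′} → Free (inj₁ j) → Free (inj₁ j′) → inj₁ j ~ inj₁ j′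
    branches {j} {j′} j! j′! with j ≟ᶠ j′
    ... | yes refl = ~-refl
    ... | no j≢j′ = across-joins (link-joins j j′ j≢j′) (clear _ i∉) j! j′!
      where
      i∉ : ¬ i ∈ᵉ link j j′
      i∉ i∈ with link-joins j j′ j≢j′ | i∈
      ... | inj₁ (s , _) | inj₁ eq = proj₁ j! (cong inj₁ (trans (≡-sym s) eq))
      ... | inj₁ (_ , t) | inj₂ eq = proj₁ j′! (cong inj₁ (trans (≡-sym t) eq))
      ... | inj₂ (s , _) | inj₁ eq = proj₁ j′! (cong inj₁ (trans (≡-sym s) eq))
      ... | inj₂ (_ , t) | inj₂ eq = proj₁ j! (cong inj₁ (trans (≡-sym t) eq))

    -- On an edge at `i`, walk away from `i`: the far end is not adjacent to `i`, because this edge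
    -- has inner vertices. On an edge off `i`, the matching hypothesis leaves an end that is not
    -- adjacent to `i`.
    anchor : ∀ {s} → Free s → Σ (Fin 4) λ j → Free (inj₁ j) × s ~ inj₁ j
    anchor {inj₁ j} j! = j , j! , ~-refl
    anchor {inj₂ (e , k)} k! with src e ≟ᶠ i | tgt e ≟ᶠ i
    ... | yes refl | yes eq = contradiction (≡-sym eq) (src≢tgt e)
    ... | yes refl | no t≢i = tgt e , t! , to-tgt′ e k t! free
      where
      t! = branch-free t≢i λ eq → contradiction
        (subst Fin (trans (≡-sym (cong len (joins-link e _ _ (inj₂ (refl , refl))))) eq) k) λ ()
      free : ∀ k′ → toℕ k ℕ.≤ toℕ k′ → Free (inj₂ (e , k′))
      free k′ k≤k′ = inner-free λ where
        (inj₁ (_ , eq)) → proj₂ k!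
          (inj₂ (first e k (ℕ.n≤0⇒n≡0 (ℕ.≤-trans k≤k′ (ℕ.≤-reflexive eq)))))
        (inj₂ (eq , _)) → t≢i eq
    ... | no s≢i | yes refl = src e , s! , to-src′ e k s! free
      where
      s! = branch-free s≢i λ eq → contradiction
        (subst Fin (trans (≡-sym (cong len (joins-link e _ _ (inj₁ (refl , refl))))) eq) k) λ ()
      free : ∀ k′ → toℕ k′ ℕ.≤ toℕ k → Free (inj₂ (e , k′))
      free k′ k′≤k = inner-free λ where
        (inj₁ (eq , _)) → s≢i eq
        (inj₂ (_ , eq)) → proj₂ k! (inj₁ (last e k (ℕ.≤-antisym (toℕ<n k)
          (ℕ.≤-trans (ℕ.≤-reflexive (≡-sym eq)) (s≤s k′≤k)))))
    ... | no s≢i | no t≢i with len (link (src e) i) ℕ.≟ 0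
    ...   | no ≢0 = src e , branch-free s≢i ≢0 ,
            to-src′ e k (branch-free s≢i ≢0) λ k′ _ → clear e [ s≢i , t≢i ]′ k′
    ...   | yes ≡0 = tgt e , t! , to-tgt′ e k t! λ k′ _ → clear e [ s≢i , t≢i ]′ k′
      where
      t! = branch-free t≢i λ t≡0 →
        no-flat-path s≢i t≢i (src≢tgt e) ≡0 (trans (link-sym i (tgt e)) t≡0)

    connected : ∀ {s t} → Free s → Free t → P s → P t
    connected s! t! with anchor s! | anchor t!
    ... | j , j! , s~j | j′ , j′! , t~j′ =
      proj₁ (~-trans s~j (~-trans (branches j! j′!) (~-sym t~j′)))

  module AwayFromInner (e₀ : Fin 6) (k₀ : Fin (len e₀)) (P : SubV len → Set)
    (spread : ∀ {s t} → Avoids (Sub len) (inj₂ (e₀ , k₀)) s → Avoids (Sub len) (inj₂ (e₀ , k₀)) t →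
      SubAdj len s t → P s → P t) where
    open Walk len (inj₂ (e₀ , k₀)) P spread

    clear : ∀ e → e ≢ e₀ → Clear len (inj₂ (e₀ , k₀)) e
    clear e e≢e₀ k = (λ { refl → e≢e₀ refl }) , e≢e₀ ∘ proj₁ ∘ adj-inner-inner

    branch-free : ∀ {j} → ¬ AtEnd len j e₀ k₀ → Free (inj₁ j)
    branch-free ¬end = (λ ()) , ¬end ∘ adj-branch-inner

    off-free : ∀ {j} → ¬ j ∈ᵉ e₀ → Free (inj₁ j)
    off-free j∉ = branch-free [ j∉ ∘ inj₁ ∘ proj₁ , j∉ ∘ inj₂ ∘ proj₁ ]′

    -- The neighbours of an inner vertex lie on the path over its own edge `e₀`, so a branch vertex
    -- off `e₀` always survives, and its edges to the others differ from `e₀`.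
    hub : Fin 4
    hub = proj₁ (two-off e₀)

    hub∉ : ¬ hub ∈ᵉ e₀
    hub∉ = proj₁ (proj₂ (proj₂ (proj₂ (two-off e₀))))

    to-hub : ∀ {j} → Free (inj₁ j) → inj₁ j ~ inj₁ hub
    to-hub {j} j! with j ≟ᶠ hub
    ... | yes refl = ~-refl
    ... | no j≢h = across-joins (link-joins j hub j≢h) (clear _ λ eq →
      hub∉ (subst (hub ∈ᵉ_) eq (proj₂ (∈ᵉ-joins (link-joins j hub j≢h))))) j! (off-free hub∉)

    -- On an edge other than `e₀`, leave through an end off `e₀`. On `e₀` itself, walk away from
    -- `k₀`: the end on that side is free, because `k` lies between it and `k₀`.
    reaches-hub : ∀ {s} → Free s → s ~ inj₁ hub
    reaches-hub {inj₁ j} j! = to-hub j!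
    reaches-hub {inj₂ (e , k)} k! with e ≟ᶠ e₀
    ... | no e≢e₀ with end-off e e₀ e≢e₀
    ...   | inj₁ s∉ =
            ~-trans (to-src′ e k (off-free s∉) λ k′ _ → clear e e≢e₀ k′) (to-hub (off-free s∉))
    ...   | inj₂ t∉ =
            ~-trans (to-tgt′ e k (off-free t∉) λ k′ _ → clear e e≢e₀ k′) (to-hub (off-free t∉))
    reaches-hub {inj₂ (e , k)} k! | yes refl with ℕ.<-cmp (toℕ k) (toℕ k₀)
    ... | tri≈ _ k≡k₀ _ = contradiction (cong (λ k → inj₂ (e , k)) (toℕ-injective k≡k₀)) (proj₁ k!)
    ... | tri< k<k₀ _ _ = ~-trans (to-src′ e k s! free) (to-hub s!)
      where
      1+k<k₀ = ℕ.≤∧≢⇒< k<k₀ λ eq → proj₂ k! (inj₁ (step e k k₀ eq))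
      s! = branch-free λ where
        (inj₁ (_ , eq)) → ℕ.n≮0 (ℕ.≤-trans k<k₀ (ℕ.≤-reflexive eq))
        (inj₂ (eq , _)) → src≢tgt e (≡-sym eq)
      free : ∀ k′ → toℕ k′ ℕ.≤ toℕ k → Free (inj₂ (e , k′))
      free k′ k′≤k = (λ { refl → ℕ.<⇒≱ k<k₀ k′≤k }) ,
        λ adj → case proj₂ (adj-inner-inner adj) of λ where
        (inj₁ eq) → ℕ.<-irrefl eq (ℕ.≤-<-trans (s≤s k′≤k) 1+k<k₀)
        (inj₂ eq) → ℕ.<⇒≱ k<k₀ (ℕ.≤-trans (ℕ.n≤1+n _) (ℕ.≤-trans (ℕ.≤-reflexive eq) k′≤k))
    ... | tri> _ _ k₀<k = ~-trans (to-tgt′ e k t! free) (to-hub t!)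
      where
      1+k₀<k = ℕ.≤∧≢⇒< k₀<k λ eq → proj₂ k! (inj₂ (step e k₀ k eq))
      t! = branch-free λ where
        (inj₁ (eq , _)) → src≢tgt e eq
        (inj₂ (_ , eq)) → ℕ.<⇒≱ k₀<k (ℕ.s≤s⁻¹ (ℕ.≤-trans (toℕ<n k) (ℕ.≤-reflexive (≡-sym eq))))
      free : ∀ k′ → toℕ k ℕ.≤ toℕ k′ → Free (inj₂ (e , k′))
      free k′ k≤k′ = (λ { refl → ℕ.<⇒≱ k₀<k k≤k′ }) ,
        λ adj → case proj₂ (adj-inner-inner adj) of λ where
        (inj₁ eq) → ℕ.<⇒≱ k₀<k (ℕ.≤-trans k≤k′ (ℕ.≤-trans (ℕ.n≤1+n _) (ℕ.≤-reflexive eq)))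
        (inj₂ eq) → ℕ.<-irrefl eq (ℕ.<-≤-trans 1+k₀<k k≤k′)

    connected : ∀ {s t} → Free s → Free t → P s → P t
    connected s! t! = proj₁ (~-trans (reaches-hub s!) (~-sym (reaches-hub t!)))

  sub-no-star-cutset : NoStarCutset (Sub len)
  sub-no-star-cutset (inj₁ i) P spread = AwayFromBranch.connected i P spread
  sub-no-star-cutset (inj₂ (e , k)) P spread = AwayFromInner.connected e k P spread

  no-flat-path′ : ∀ {i j k} → i ≢ k →
    SubAdj len (inj₁ i) (inj₁ j) → ¬ SubAdj len (inj₁ j) (inj₁ k)
  no-flat-path′ i≢k i~j j~k with i≢j , p ← adj-branch-branch i~j | j≢k , q ← adj-branch-branch j~k =
    no-flat-path i≢j (≢-sym j≢k) i≢k p q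

  -- Absence of dominating edges

  OnPath : Fin 6 → SubV len → Set
  OnPath e (inj₁ i) = i ∈ᵉ e
  OnPath e (inj₂ (e′ , _)) = e ≡ e′

  arc-on-path : ∀ {u v} → SubArc len u v → Σ (Fin 6) λ e → OnPath e u × OnPath e v
  arc-on-path (direct e _) = e , inj₁ refl , inj₂ refl
  arc-on-path (first e _ _) = e , inj₁ refl , refl
  arc-on-path (last e _ _) = e , refl , inj₂ refl
  arc-on-path (step e _ _ _) = e , refl , refl

  off-neighbour : ∀ {e i u} → ¬ i ∈ᵉ e → OnPath e u → SubAdj len (inj₁ i) u →
    Σ (Fin 4) λ j → u ≡ inj₁ j × j ∈ᵉ e
  off-neighbour {u = inj₁ j} _ j∈ _ = j , refl , j∈
  off-neighbour {u = inj₂ _} i∉ refl i~u with adj-branch-inner i~u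
  ... | inj₁ (eq , _) = contradiction (inj₁ eq) i∉
  ... | inj₂ (eq , _) = contradiction (inj₂ eq) i∉

  off-≢ : ∀ {e i u} → ¬ i ∈ᵉ e → OnPath e u → inj₁ i ≢ u
  off-≢ i∉ on refl = i∉ on

  -- The two vertices of K₄ off the edge e cannot both be adjacent to u or v: two unsubdivided
  -- edges would share a vertex.
  arc-not-dominating : ∀ {u v} → SubArc len u v →
    ¬ (∀ y → ¬ (Avoids (Sub len) u y × Avoids (Sub len) v y))
  arc-not-dominating {u} {v} u→v dominates with arc-on-path u→v
  ... | e , u∈ , v∈ with two-off e
  ...   | p , q , p≢q , p∉ , q∉ = touches p∉ λ p~ → touches q∉ λ q~ → clash p~ q~
    where
    touches : ∀ {i} → ¬ i ∈ᵉ e → ¬ ¬ (SubAdj len (inj₁ i) u ⊎ SubAdj len (inj₁ i) v)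
    touches {i} i∉ ¬adj = dominates (inj₁ i)
      ((off-≢ i∉ u∈ , ¬adj ∘ inj₁) , (off-≢ i∉ v∈ , ¬adj ∘ inj₂))

    same : ∀ {x} → OnPath e x → SubAdj len (inj₁ p) x → ¬ SubAdj len (inj₁ q) x
    same x∈ p~x q~x with off-neighbour p∉ x∈ p~x
    ... | j , refl , _ = no-flat-path′ p≢q p~x (swap q~x)

    different : ∀ {x y} → OnPath e x → OnPath e y → SubAdj len x y →
      SubAdj len (inj₁ p) x → ¬ SubAdj len (inj₁ q) y
    different x∈ y∈ x~y p~x q~y with off-neighbour p∉ x∈ p~x | off-neighbour q∉ y∈ q~y
    -- Both `x` and `y` are branch vertices here, so the edge between them is unsubdivided and meets
    -- the unsubdivided edge from `p`.
    ... | j , refl , _ | k , refl , k∈ = no-flat-path′ (λ { refl → p∉ k∈ }) p~x x~y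

    clash : SubAdj len (inj₁ p) u ⊎ SubAdj len (inj₁ p) v →
      ¬ (SubAdj len (inj₁ q) u ⊎ SubAdj len (inj₁ q) v)
    clash (inj₁ p~u) (inj₁ q~u) = same u∈ p~u q~u
    clash (inj₁ p~u) (inj₂ q~v) = different u∈ v∈ (inj₁ u→v) p~u q~v
    clash (inj₂ p~v) (inj₁ q~u) = different v∈ u∈ (inj₂ u→v) p~v q~u
    clash (inj₂ p~v) (inj₂ q~v) = same v∈ p~v q~v

  sub-no-dominating-edge : NoDominatingEdge (Sub len)
  sub-no-dominating-edge (inj₁ u→v) = arc-not-dominating u→v
  sub-no-dominating-edge (inj₂ v→u) dominates =
    arc-not-dominating v→u λ y (y-v , y-u) → dominates y (y-u , y-v)

-- Cycles over the triangles of K₄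

module _ {len : Fin 6 → ℕ} where

  -- The cycle over the triangle of K₄ that misses t.
  Triangle : Fin 4 → SubV len → Set
  Triangle t (inj₁ i) = i ≢ t
  Triangle t (inj₂ (e , _)) = ¬ t ∈ᵉ e

  triangle? : ∀ t → Decidable (Triangle t)
  triangle? t (inj₁ i) = ¬? (i ≟ᶠ t)
  triangle? t (inj₂ (e , _)) = ¬? (t ∈ᵉ? e)

  -- A corner of K₄ whose opposite triangle gives a cycle missing the vertex; for an inner vertex
  -- either end of its edge would do.
  missing : SubV len → Fin 4
  missing (inj₁ i) = i
  missing (inj₂ (e , _)) = src e

  missing-∉ : ∀ u → ¬ Triangle (missing u) u
  missing-∉ (inj₁ i) i≢i = i≢i refl
  missing-∉ (inj₂ (e , _)) s∉e = s∉e (inj₁ refl)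

  inner : ∀ e → Fin (len e) → SubV len
  inner e k = inj₂ (e , k)

  inner-vertices : Fin 6 → List (SubV len)
  inner-vertices e = map (inner e) (allFin (len e))

  vertices : List (SubV len)
  vertices = map inj₁ (allFin 4) ++
    concatMap inner-vertices (allFin 6)

  ∈-vertices : ∀ x → x ∈ vertices
  ∈-vertices (inj₁ i) = ∈-++⁺ˡ (∈-map⁺ inj₁ (∈-allFin i))
  ∈-vertices (inj₂ (e , k)) = ∈-++⁺ʳ (map inj₁ (allFin 4))
    (∈-concatMap⁺ inner-vertices
      (Any.map (λ { refl → ∈-map⁺ (inner e) (∈-allFin k) }) (∈-allFin e)))

  maximum : ∀ {C : SubV len → Set} → Decidable C → (f : SubV len → ℚ) → Σ _ C →
    Σ (SubV len) λ x → C x × ∀ {y} → C y → f y ℚ.≤ f x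
  maximum C? f (x₀ , x₀∈) = argmax f x₀ xs ,
    argmax-all f x₀∈ (all-filter C? vertices) ,
    λ {y} y∈ → lookup (f[xs]≤f[argmax] {f = f} x₀ xs) (∈-filter⁺ C? (∈-vertices y) y∈)
    where xs = filter C? vertices

  record Arm (e : Fin 6) (i p t : Fin 4) : Set where
    field
      end : SubV len
      adjacent : SubAdj len (inj₁ i) end
      in-triangle : Triangle t end
      along : end ≡ inj₁ p ⊎ Σ (Fin (len e)) λ k → end ≡ inj₂ (e , k)

  arm : ∀ {e i p t} → Joins e i p → i ≢ t → p ≢ t → Arm e i p t
  arm {e} (inj₁ (refl , refl)) i≢t p≢t with first-or-empty (len e)
  ... | inj₁ flat = record
    { adjacent = inj₁ (direct e flat) ; in-triangle = p≢t ; along = inj₁ refl }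
  ... | inj₂ (k , eq) = record
    { adjacent = inj₁ (first e k eq) ; in-triangle = [ i≢t , p≢t ]′ ; along = inj₂ (k , refl) }
  arm {e} (inj₂ (refl , refl)) i≢t p≢t with last-or-empty (len e)
  ... | inj₁ flat = record
    { adjacent = inj₂ (direct e flat) ; in-triangle = p≢t ; along = inj₁ refl }
  ... | inj₂ (k , eq) = record
    { adjacent = inj₂ (last e k eq) ; in-triangle = [ p≢t , i≢t ]′ ; along = inj₂ (k , refl) }

  arms-differ : ∀ {e e′ i p q t} → e ≢ e′ → p ≢ q → (A : Arm e i p t) (B : Arm e′ i q t) →
    Arm.end A ≢ Arm.end B
  arms-differ e≢e′ p≢q record { along = inj₁ refl } record { along = inj₁ refl } refl = p≢q refl
  arms-differ e≢e′ p≢q record { along = inj₁ refl } record { along = inj₂ (_ , refl) } ()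
  arms-differ e≢e′ p≢q record { along = inj₂ (_ , refl) } record { along = inj₁ refl } ()
  arms-differ e≢e′ p≢q record { along = inj₂ (_ , refl) } record { along = inj₂ (_ , refl) } refl =
    e≢e′ refl

  TwoNeighbours : Fin 4 → SubV len → Set
  TwoNeighbours t x = Σ (SubV len) λ y → Σ (SubV len) λ z →
    y ≢ z × (SubAdj len x y × Triangle t y) × (SubAdj len x z × Triangle t z)

  inner-two-neighbours : ∀ {t e} k → ¬ t ∈ᵉ e → TwoNeighbours t (inj₂ (e , k))
  inner-two-neighbours {t} {e} k t∉e with pred-or-zero k | suc-or-last k
  ... | inj₁ start | inj₁ end = _ , _ , src≢tgt e ∘ inj₁-injective ,
    (inj₂ (first e k start) , t∉e ∘ inj₁) , (inj₁ (last e k end) , t∉e ∘ inj₂)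
  ... | inj₁ start | inj₂ (k⁺ , eq⁺) = _ , _ , (λ ()) ,
    (inj₂ (first e k start) , t∉e ∘ inj₁) , (inj₁ (step e k k⁺ eq⁺) , t∉e)
  ... | inj₂ (k⁻ , eq⁻) | inj₁ end = _ , _ , (λ ()) ,
    (inj₂ (step e k⁻ k eq⁻) , t∉e) , (inj₁ (last e k end) , t∉e ∘ inj₂)
  ... | inj₂ (k⁻ , eq⁻) | inj₂ (k⁺ , eq⁺) = _ , _ ,
    (λ eq → ℕ.<⇒≢ (ℕ.<-trans (ℕ.≤-reflexive eq⁻) (ℕ.≤-reflexive eq⁺))
      (cong toℕ (inner-injective eq))) ,
    (inj₂ (step e k⁻ k eq⁻) , t∉e) , (inj₁ (step e k k⁺ eq⁺) , t∉e)

  two-neighbours : ∀ {t} x → Triangle t x → TwoNeighbours t x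
  two-neighbours {t} (inj₁ i) i≢t with two-others i t
  ... | p , q , p≢i , q≢i , p≢t , q≢t , p≢q , links≢ =
    end A , end B , arms-differ links≢ p≢q A B ,
    (adjacent A , in-triangle A) , (adjacent B , in-triangle B)
    where
    open Arm
    A = arm (link-joins i p (≢-sym p≢i)) i≢t p≢t
    B = arm (link-joins i q (≢-sym q≢i)) i≢t q≢t
  two-neighbours (inj₂ (e , k)) t∉e = inner-two-neighbours k t∉e

  triangle-inhabited : ∀ t → Σ (SubV len) (Triangle t)
  triangle-inhabited t with two-others t t
  ... | p , _ , p≢t , _ = inj₁ p , p≢t

  sub-has-peaks : HasPeaks (Sub len)
  sub-has-peaks u f with maximum (triangle? (missing u)) f (triangle-inhabited (missing u))
  ... | x , x∈ , max with two-neighbours x x∈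
  ...   | y , z , y≢z , (x~y , y∈) , (x~z , z∈) =
    x , y , z , avoids y∈ , avoids z∈ , y≢z , x~y , x~z , max y∈ , max z∈
    where
    avoids : ∀ {y} → Triangle (missing u) y → y ≢ u
    avoids y∈ refl = missing-∉ u y∈

matching-not-representable : ∀ {len} → TriangleFree (Sub len) →
  (∀ {e e′} → e ≢ e′ → len e ≡ 0 → len e′ ≡ 0 → ¬ ShareVertex e e′) →
  ¬ RestrictedFrameRep (Sub len)
matching-not-representable tf matching R = not-representable R tf
  (sub-no-star-cutset matching) sub-has-peaks (sub-no-dominating-edge matching) (inj₁ zero)

-- Natural coordinates and chains of frames

ι : ℕ → ℚ
ι n = mkℚ (ℤ.+ n) 0 (Coprimality.sym (Coprimality.1-coprimeTo n))

ι-mono : ∀ {m n} → m < n → ι m ℚ.< ι n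
ι-mono m<n = ℚ.*<* (ℤ.*-monoʳ-<-pos (ℤ.+ 1) (ℤ.+<+ m<n))

record Box : Set where
  constructor box
  field
    {left right bottom top} : ℕ
    left<right : left < right
    bottom<top : bottom < top

open Box

⌞_⌟ : Box → Frame
⌞ B ⌟ = record
  { a = ι (left B) ; b = ι (right B) ; c = ι (bottom B) ; d = ι (top B)
  ; a<b = ι-mono (left<right B) ; c<d = ι-mono (bottom<top B) }

crosses-ι : ∀ {B C} → left B < left C → left C < right B → right B < right C →
  bottom B < bottom C → top C < top B → Crosses ⌞ B ⌟ ⌞ C ⌟
crosses-ι p q r s t = crosses (ι-mono p) (ι-mono q) (ι-mono r) (ι-mono s) (ι-mono t)

inside-ι : ∀ {B C} → left C < left B → right B < right C → bottom C < bottom B → top B < top C →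
  Inside ⌞ B ⌟ ⌞ C ⌟
inside-ι p q r s = inside (ι-mono p) (ι-mono q) (ι-mono r) (ι-mono s)

-- A chain of `p + 1 + q` positions with one marked. The constructors match the pieces of paths that
-- the embeddings put into a strip, so adjacencies can be compared case by case.
data Slot (p q : ℕ) : Set where
  before : Fin p → Slot p q
  middle : Slot p q
  after : Fin q → Slot p q

module _ {p q : ℕ} where

  index : Slot p q → ℕ
  index (before i) = toℕ i
  index middle = p
  index (after j) = suc p + toℕ j

  index-bound : ∀ s → index s < suc p + q
  index-bound (before i) = ℕ.≤-trans (toℕ<n i) (ℕ.≤-trans (ℕ.n≤1+n p) (ℕ.m≤m+n (suc p) q))
  index-bound middle = ℕ.m≤m+n (suc p) q
  index-bound (after j) = ℕ.+-monoʳ-< (suc p) (toℕ<n j)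

  index-injective : ∀ {s t} → index s ≡ index t → s ≡ t
  index-injective {before i} {before j} eq = cong before (toℕ-injective eq)
  index-injective {before i} {middle} eq = contradiction eq (ℕ.<⇒≢ (toℕ<n i))
  index-injective {before i} {after j} eq =
    contradiction eq (ℕ.<⇒≢ (ℕ.<-≤-trans (toℕ<n i) (ℕ.m≤n⇒m≤1+n (ℕ.m≤m+n p _))))
  index-injective {middle} {before j} eq = contradiction (≡-sym eq) (ℕ.<⇒≢ (toℕ<n j))
  index-injective {middle} {middle} eq = refl
  index-injective {middle} {after j} eq = contradiction eq (ℕ.<⇒≢ (s≤s (ℕ.m≤m+n p _)))
  index-injective {after i} {before j} eq =
    contradiction (≡-sym eq) (ℕ.<⇒≢ (ℕ.<-≤-trans (toℕ<n j) (ℕ.m≤n⇒m≤1+n (ℕ.m≤m+n p _))))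
  index-injective {after i} {middle} eq = contradiction (≡-sym eq) (ℕ.<⇒≢ (s≤s (ℕ.m≤m+n p _)))
  index-injective {after i} {after j} eq = cong after (toℕ-injective (ℕ.+-cancelˡ-≡ (suc p) _ _ eq))

  First Last : Slot p q → Set
  First (before i) = toℕ i ≡ 0
  First middle = p ≡ 0
  First (after _) = ⊥
  Last (before _) = ⊥
  Last middle = q ≡ 0
  Last (after j) = suc (toℕ j) ≡ q

  Next : Slot p q → Slot p q → Set
  Next (before i) (before j) = suc (toℕ i) ≡ toℕ j
  Next (before i) middle = suc (toℕ i) ≡ p
  Next middle (after j) = toℕ j ≡ 0
  Next (after i) (after j) = suc (toℕ i) ≡ toℕ j
  Next _ _ = ⊥

  First⇒index : ∀ s → First s → index s ≡ 0
  First⇒index (before i) eq = eq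
  First⇒index middle eq = eq

  index⇒First : ∀ s → index s ≡ 0 → First s
  index⇒First (before i) eq = eq
  index⇒First middle eq = eq

  Last⇒index : ∀ s → Last s → index s ≡ p + q
  Last⇒index middle eq = ≡-sym (trans (cong (p +_) eq) (ℕ.+-identityʳ p))
  Last⇒index (after j) eq = trans (≡-sym (ℕ.+-suc p _)) (cong (p +_) eq)

  index⇒Last : ∀ s → index s ≡ p + q → Last s
  index⇒Last (before i) eq = contradiction eq (ℕ.<⇒≢ (ℕ.<-≤-trans (toℕ<n i) (ℕ.m≤m+n p q)))
  index⇒Last middle eq = ≡-sym (ℕ.+-cancelˡ-≡ p 0 q (trans (ℕ.+-identityʳ p) eq))
  index⇒Last (after j) eq = ℕ.+-cancelˡ-≡ p _ q (trans (ℕ.+-suc p _) eq)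

  Next⇒index : ∀ s t → Next s t → suc (index s) ≡ index t
  Next⇒index (before i) (before j) eq = eq
  Next⇒index (before i) middle eq = eq
  Next⇒index middle (after j) eq = cong suc (≡-sym (trans (cong (p +_) eq) (ℕ.+-identityʳ p)))
  Next⇒index (after i) (after j) eq = cong suc (trans (≡-sym (ℕ.+-suc p _)) (cong (p +_) eq))

  index⇒Next : ∀ s t → suc (index s) ≡ index t → Next s t
  index⇒Next (before i) (before j) eq = eq
  index⇒Next (before i) middle eq = eq
  index⇒Next (before i) (after j) eq = contradiction (ℕ.suc-injective eq)
    (ℕ.<⇒≢ (ℕ.<-≤-trans (toℕ<n i) (ℕ.m≤m+n p _)))
  index⇒Next middle (before j) eq = contradiction (≡-sym eq) (ℕ.<⇒≢ (ℕ.m≤n⇒m≤1+n (toℕ<n j)))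
  index⇒Next middle middle eq = contradiction (≡-sym eq) (ℕ.<⇒≢ (ℕ.n<1+n p))
  index⇒Next middle (after j) eq = ≡-sym (ℕ.+-cancelˡ-≡ p 0 _
    (trans (ℕ.+-identityʳ p) (ℕ.suc-injective eq)))
  index⇒Next (after i) (before j) eq = contradiction (≡-sym eq)
    (ℕ.<⇒≢ (ℕ.<-≤-trans (toℕ<n j) (ℕ.m≤n⇒m≤1+n (ℕ.m≤n⇒m≤1+n (ℕ.m≤m+n p _)))))
  index⇒Next (after i) middle eq = contradiction (≡-sym eq)
    (ℕ.<⇒≢ (s≤s (ℕ.m≤n⇒m≤1+n (ℕ.m≤m+n p _))))
  index⇒Next (after i) (after j) eq = ℕ.+-cancelˡ-≡ p _ _
    (trans (ℕ.+-suc p _) (ℕ.suc-injective eq))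

-- Truncated subtraction makes this the indicator of t ≤ k.
[_≤_]₀₁ : ℕ → ℕ → ℕ
[ t ≤ k ]₀₁ = 1 ∸ (t ∸ k)

module _ {t k : ℕ} where

  ind-yes : t ≤ k → [ t ≤ k ]₀₁ ≡ 1
  ind-yes t≤k rewrite ℕ.m≤n⇒m∸n≡0 t≤k = refl

  ind-no : k < t → [ t ≤ k ]₀₁ ≡ 0
  ind-no k<t = ℕ.m≤n⇒m∸n≡0 (ℕ.m<n⇒0<n∸m k<t)

  ind≤1 : [ t ≤ k ]₀₁ ≤ 1
  ind≤1 = ℕ.m∸n≤m 1 (t ∸ k)

ind-mono : ∀ t {k k′} → k ≤ k′ → [ t ≤ k ]₀₁ ≤ [ t ≤ k′ ]₀₁
ind-mono t k≤k′ = ℕ.∸-monoʳ-≤ 1 (ℕ.∸-monoʳ-≤ t k≤k′)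

module Cuts (N : ℕ) (τ : Fin 3 → ℕ) (τ₀≤τ₁ : τ 0F ≤ τ 1F) (τ₁≤τ₂ : τ 1F ≤ τ 2F) where

  -- The number of thresholds that are at most `k`. As these are ordered, it exceeds `i` exactly
  -- when `τ i ≤ k`.
  level : ℕ → ℕ
  level k = [ τ 0F ≤ k ]₀₁ + ([ τ 1F ≤ k ]₀₁ + [ τ 2F ≤ k ]₀₁)

  level-mono : ∀ {k k′} → k ≤ k′ → level k ≤ level k′
  level-mono k≤k′ = ℕ.+-mono-≤ (ind-mono (τ 0F) k≤k′)
    (ℕ.+-mono-≤ (ind-mono (τ 1F) k≤k′) (ind-mono (τ 2F) k≤k′))

  level-above : ∀ i {k} → τ i ≤ k → toℕ i < level k
  level-above 0F {k} τ≤k rewrite ind-yes τ≤k = s≤s z≤n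
  level-above 1F {k} τ≤k rewrite ind-yes (ℕ.≤-trans τ₀≤τ₁ τ≤k) | ind-yes τ≤k = s≤s (s≤s z≤n)
  level-above 2F {k} τ≤k
    rewrite ind-yes (ℕ.≤-trans τ₀≤τ₁ (ℕ.≤-trans τ₁≤τ₂ τ≤k)) 
          | ind-yes (ℕ.≤-trans τ₁≤τ₂ τ≤k) | ind-yes τ≤k
    = ℕ.≤-refl

  level-below : ∀ i {k} → k < τ i → level k ≤ toℕ i
  level-below 0F k<τ
    rewrite ind-no k<τ | ind-no (ℕ.<-≤-trans k<τ τ₀≤τ₁)
          | ind-no (ℕ.<-≤-trans k<τ (ℕ.≤-trans τ₀≤τ₁ τ₁≤τ₂))
    = z≤n
  level-below 1F {k} k<τ rewrite ind-no k<τ | ind-no (ℕ.<-≤-trans k<τ τ₁≤τ₂) =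
    ℕ.≤-trans (ℕ.≤-reflexive (ℕ.+-identityʳ _)) (ind≤1 {τ 0F} {k})
  level-below 2F {k} k<τ rewrite ind-no k<τ =
    ℕ.+-mono-≤ (ind≤1 {τ 0F} {k}) (ℕ.≤-trans (ℕ.≤-reflexive (ℕ.+-identityʳ _)) (ind≤1 {τ 1F} {k}))

  -- The position of the overlap between the frames k - 1 and k of a strip: the multiple of N
  -- puts it between the walls that it must separate.
  cut : ℕ → ℕ
  cut k = level k * N + k

  cut-mono : ∀ {k k′} → k < k′ → cut k < cut k′
  cut-mono k<k′ = ℕ.+-mono-≤-< (ℕ.*-monoˡ-≤ N (level-mono (ℕ.<⇒≤ k<k′))) k<k′

  cut-above : ∀ i {k} → τ i ≤ k → suc (toℕ i) * N ≤ cut k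
  cut-above i τ≤k = ℕ.≤-trans (ℕ.*-monoˡ-≤ N (level-above i τ≤k)) (ℕ.m≤m+n _ _)

  -- The bound on `k` keeps the remainder from reaching the next multiple of `N`. The additional
  -- `suc` covers the right end of a frame, which extends past the cut.
  cut-below : ∀ i {k} → suc k < N → k < τ i → suc (cut k) < suc (toℕ i) * N
  cut-below i {k} 1+k<N k<τ = begin-strict
    suc (level k * N + k) ≡⟨ ℕ.+-suc (level k * N) k ⟨
    level k * N + suc k   ≤⟨ ℕ.+-monoˡ-≤ (suc k) (ℕ.*-monoˡ-≤ N (level-below i k<τ)) ⟩
    toℕ i * N + suc k     <⟨ ℕ.+-monoʳ-< (toℕ i * N) 1+k<N ⟩
    toℕ i * N + N         ≡⟨ ℕ.+-comm (toℕ i * N) N ⟩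
    suc (toℕ i) * N       ∎
    where open ℕ.≤-Reasoning

bounded : ∀ {m} (f : Fin m → ℕ) → Σ ℕ λ N → ∀ i → f i ≤ N
bounded {zero} f = 0 , λ ()
bounded {suc m} f with bounded (f ∘ suc)
... | N , f≤N = f zero + N , λ where
  zero → ℕ.m≤m+n _ _
  (suc i) → ℕ.≤-trans (f≤N i) (ℕ.m≤n+m N _)

-- Tall frames cutting across strips

-- Three tall frames, whose right sides lie on the lines x = wall 0 < wall 1 < wall 2, cut across
-- disjoint horizontal strips. Each strip is a chain of frames, each crossing the next, in which
-- wall 0 hits the first frame (or runs to the left of the strip if that is not active), wall 1
-- the middle frame and wall 2 the last frame. Tall frame 0 crosses tall frame 1 when linked and
-- lies inside it otherwise; both lie inside tall frame 2.
record Strips : Set where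
  field
    count : ℕ
    pre post : Fin count → ℕ
    active : Fin count → Bool
    linked : Bool

  Vertex : Set
  Vertex = Fin 3 ⊎ Σ (Fin count) λ σ → Slot (pre σ) (post σ)

  Hits : Fin 3 → ∀ σ → Slot (pre σ) (post σ) → Set
  Hits 0F σ s = active σ ≡ true × First s
  Hits 1F σ s = s ≡ middle
  Hits 2F σ s = Last s

  data Arc : Vertex → Vertex → Set where
    hit : ∀ i σ s → Hits i σ s → Arc (inj₁ i) (inj₂ (σ , s))
    next : ∀ σ s t → Next s t → Arc (inj₂ (σ , s)) (inj₂ (σ , t))
    bond : linked ≡ true → Arc (inj₁ 0F) (inj₁ 1F)

  -- One more than the index of the frame of the strip hit by the wall, so that 0 means none.
  τ : Fin count → Fin 3 → ℕ
  τ σ 0F = if active σ then 1 else 0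
  τ σ 1F = suc (pre σ)
  τ σ 2F = suc (pre σ + post σ)

  τ₀≤1 : ∀ σ → τ σ 0F ≤ 1
  τ₀≤1 σ with active σ
  ... | true = ℕ.≤-refl
  ... | false = z≤n

  τ₀≤τ₁ : ∀ σ → τ σ 0F ≤ τ σ 1F
  τ₀≤τ₁ σ = ℕ.≤-trans (τ₀≤1 σ) (s≤s z≤n)

  τ₁≤τ₂ : ∀ σ → τ σ 1F ≤ τ σ 2F
  τ₁≤τ₂ σ = s≤s (ℕ.m≤m+n (pre σ) (post σ))

  Hits⇒τ : ∀ i σ s → Hits i σ s → suc (index s) ≡ τ σ i
  Hits⇒τ 0F σ s (on , f) rewrite on = cong suc (First⇒index s f)
  Hits⇒τ 1F σ s refl = refl
  Hits⇒τ 2F σ s l = cong suc (Last⇒index s l)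

  τ⇒Hits : ∀ i σ s → suc (index s) ≡ τ σ i → Hits i σ s
  τ⇒Hits 0F σ s eq with active σ | eq
  ... | true | 1≡1 = refl , index⇒First s (ℕ.suc-injective 1≡1)
  ... | false | ()
  τ⇒Hits 1F σ s eq = index-injective (ℕ.suc-injective eq)
  τ⇒Hits 2F σ s eq = index⇒Last s (ℕ.suc-injective eq)

  slots : Fin count → ℕ
  slots σ = suc (pre σ) + post σ

  -- One spacing for all strips, since they share the walls. The `2` makes room for the two
  -- successors in `index<N`.
  N : ℕ
  N = 2 + proj₁ (bounded slots)

  index<N : ∀ {σ} (s : Slot (pre σ) (post σ)) → suc (suc (index s)) < N
  index<N {σ} s = s≤s (s≤s (ℕ.≤-trans (index-bound s) (proj₂ (bounded slots) σ)))

  module C σ = Cuts N (τ σ) (τ₀≤τ₁ σ) (τ₁≤τ₂ σ)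

  -- A strip needs height at most `N + N`, and one unit separates it from the next. The heights 0 to
  -- 2 below the first strip are for the bottoms of the tall frames.
  base : ℕ → ℕ
  base i = i * suc (N + N) + 3

  base-mono : ∀ {i j} → i < j → base i + (N + N) < base j
  base-mono {i} {j} i<j = begin-strict
    i * suc (N + N) + 3 + (N + N)     ≡⟨ ℕ.+-assoc (i * suc (N + N)) 3 (N + N) ⟩
    i * suc (N + N) + (3 + (N + N))   <⟨ ℕ.+-monoʳ-< (i * suc (N + N)) (ℕ.n<1+n _) ⟩
    i * suc (N + N) + (4 + (N + N))   ≡⟨ cong (i * suc (N + N) +_) (ℕ.+-comm 3 (suc (N + N))) ⟩
    i * suc (N + N) + (suc (N + N) + 3) ≡⟨ ℕ.+-assoc (i * suc (N + N)) (suc (N + N)) 3 ⟨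
    i * suc (N + N) + suc (N + N) + 3 ≡⟨ cong (_+ 3) (ℕ.+-comm (i * suc (N + N)) (suc (N + N))) ⟩
    suc i * suc (N + N) + 3           ≤⟨ ℕ.+-monoˡ-≤ 3 (ℕ.*-monoˡ-≤ (suc (N + N)) i<j) ⟩
    j * suc (N + N) + 3               ∎
    where open ℕ.≤-Reasoning

  -- The inset of a tall frame at its left, bottom and top. The right sides stay at the walls, so
  -- exchanging the insets 1 and 2 turns the nesting of tall frames 0 and 1 into a crossing.
  depth : Fin 3 → ℕ
  depth 0F = if linked then 1 else 2
  depth 1F = if linked then 2 else 1
  depth 2F = 0

  depth≤2 : ∀ i → depth i ≤ 2
  depth≤2 0F with linked
  ... | true = s≤s z≤n
  ... | false = ℕ.≤-refl
  depth≤2 1F with linked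
  ... | true = ℕ.≤-refl
  ... | false = s≤s z≤n
  depth≤2 2F = z≤n

  wall : Fin 3 → ℕ
  wall i = 2 + 2 * (suc (toℕ i) * N)

  wall-mono : ∀ {i j} → toℕ i < toℕ j → wall i < wall j
  wall-mono i<j = s≤s (s≤s (ℕ.*-monoʳ-< 2 (ℕ.*-monoˡ-< N (s≤s i<j))))

  2<wall : ∀ i → 2 < wall i
  2<wall i = s≤s (s≤s (s≤s z≤n))

  tall : Fin 3 → Box
  tall i = record
    { left = depth i ; right = wall i ; bottom = depth i ; top = base count + (2 ∸ depth i)
    ; left<right = ℕ.≤-<-trans (depth≤2 i) (2<wall i)
    ; bottom<top = ℕ.≤-trans (s≤s (depth≤2 i))
        (ℕ.≤-trans (ℕ.m≤n+m 3 (count * suc (N + N))) (ℕ.m≤m+n (base count) _)) }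

  -- Tops descend along a strip while bottoms rise, because a crossed frame is shorter at both ends
  -- than the frame crossing it.
  height : ℕ → ℕ
  height k = N + (N ∸ k)

  k<height : ∀ {k} → k < N → k < height k
  k<height k<N = ℕ.≤-trans k<N (ℕ.m≤m+n N _)

  -- Frame `k + 1` starts one unit before frame `k` ends, and frame `k + 2` starts after that end.
  nodeˡ nodeʳ : Fin count → ℕ → ℕ
  nodeˡ σ k = 3 + 2 * C.cut σ k
  nodeʳ σ k = 4 + 2 * C.cut σ (suc k)

  nodeˡ-mono : ∀ σ {k k′} → k < k′ → nodeˡ σ k < nodeˡ σ k′
  nodeˡ-mono σ k<k′ = ℕ.+-monoʳ-< 3 (ℕ.*-monoʳ-< 2 (C.cut-mono σ k<k′))

  nodeʳ-mono : ∀ σ {k k′} → k < k′ → nodeʳ σ k < nodeʳ σ k′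
  nodeʳ-mono σ k<k′ = ℕ.+-monoʳ-< 4 (ℕ.*-monoʳ-< 2 (C.cut-mono σ (s≤s k<k′)))

  double-< : ∀ {m n} → m < n → suc (2 * m) < 2 * n
  double-< {m} {n} m<n = ℕ.≤-trans (ℕ.≤-reflexive (≡-sym (ℕ.*-suc 2 m))) (ℕ.*-monoʳ-≤ 2 m<n)

  nodeʳ<nodeˡ : ∀ σ {k k′} → suc k < k′ → nodeʳ σ k < nodeˡ σ k′
  nodeʳ<nodeˡ σ 1+k<k′ = ℕ.+-monoʳ-< 3 (double-< (C.cut-mono σ 1+k<k′))

  node : ∀ σ → Slot (pre σ) (post σ) → Box
  node σ s = record
    { left = nodeˡ σ (index s) ; right = nodeʳ σ (index s)
    ; bottom = base (toℕ σ) + index s ; top = base (toℕ σ) + height (index s)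
    ; left<right = ℕ.<-trans (nodeˡ-mono σ (ℕ.n<1+n _)) (ℕ.n<1+n _)
    ; bottom<top = ℕ.+-monoʳ-< (base (toℕ σ))
        (k<height (ℕ.<-trans (ℕ.n<1+n _) (ℕ.<-trans (ℕ.n<1+n _) (index<N s)))) }

  frame : Vertex → Frame
  frame (inj₁ i) = ⌞ tall i ⌟
  frame (inj₂ (σ , s)) = ⌞ node σ s ⌟

  Adjacent : Vertex → Vertex → Set
  Adjacent u v = Arc u v ⊎ Arc v u

  module _ (i : Fin 3) (σ : Fin count) (s : Slot (pre σ) (post σ)) where

    tall-left : depth i < nodeˡ σ (index s)
    tall-left = ℕ.≤-trans (s≤s (depth≤2 i)) (ℕ.m≤m+n 3 _)

    tall-bottom : depth i < base (toℕ σ) + index s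
    tall-bottom = ℕ.≤-trans (s≤s (depth≤2 i))
      (ℕ.≤-trans (ℕ.m≤n+m 3 (toℕ σ * suc (N + N))) (ℕ.m≤m+n (base (toℕ σ)) _))

    tall-top : base (toℕ σ) + height (index s) < base count + (2 ∸ depth i)
    tall-top = ℕ.≤-<-trans (ℕ.+-monoʳ-≤ (base (toℕ σ)) (ℕ.+-monoʳ-≤ N (ℕ.m∸n≤m N (index s))))
      (ℕ.<-≤-trans (base-mono (toℕ<n σ)) (ℕ.m≤m+n (base count) _))

    wall<nodeʳ : τ σ i ≤ suc (index s) → wall i < nodeʳ σ (index s)
    wall<nodeʳ τ≤ = s≤s (s≤s (s≤s (ℕ.m≤n⇒m≤1+n (ℕ.*-monoʳ-≤ 2 (C.cut-above σ i τ≤)))))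

    wall<nodeˡ : τ σ i ≤ index s → wall i < nodeˡ σ (index s)
    wall<nodeˡ τ≤ = s≤s (s≤s (s≤s (ℕ.*-monoʳ-≤ 2 (C.cut-above σ i τ≤))))

    nodeˡ<wall : index s < τ σ i → nodeˡ σ (index s) < wall i
    nodeˡ<wall <τ = s≤s (s≤s (double-<
      (ℕ.<-trans (ℕ.n<1+n _) (C.cut-below σ i (ℕ.<-trans (ℕ.n<1+n _) (index<N s)) <τ))))

    nodeʳ<wall : suc (index s) < τ σ i → nodeʳ σ (index s) < wall i
    nodeʳ<wall <τ = s≤s (s≤s (ℕ.≤-<-trans (ℕ.≤-reflexive (≡-sym (ℕ.*-suc 2 _)))
      (ℕ.*-monoʳ-< 2 (C.cut-below σ i (index<N s) <τ))))

    -- Frames before the threshold end left of the wall and lie inside the tall frame, the one at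
    -- the threshold is hit, and later ones start right of the wall. Threshold 0 leaves only the
    -- last case.
    Hit-layout : (Hits i σ s × Crosses ⌞ tall i ⌟ ⌞ node σ s ⌟) ⊎
      (¬ Hits i σ s × (Inside ⌞ node σ s ⌟ ⌞ tall i ⌟ ⊎ Disjoint ⌞ tall i ⌟ ⌞ node σ s ⌟))
    Hit-layout with ℕ.<-cmp (suc (index s)) (τ σ i)
    ... | tri< <τ ≢τ _ = inj₂ (≢τ ∘ Hits⇒τ i σ s ,
            inj₁ (inside-ι {node σ s} {tall i} tall-left (nodeʳ<wall <τ) tall-bottom tall-top))
    ... | tri≈ _ ≡τ _ = inj₁ (τ⇒Hits i σ s ≡τ ,
            crosses-ι {tall i} {node σ s} tall-left (nodeˡ<wall (ℕ.≤-reflexive ≡τ))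
              (wall<nodeʳ (ℕ.≤-reflexive (≡-sym ≡τ))) tall-bottom tall-top)
    ... | tri> _ ≢τ τ< = inj₂ (≢τ ∘ Hits⇒τ i σ s ,
            inj₂ (inj₁ (ι-mono (wall<nodeˡ (ℕ.s≤s⁻¹ τ<)))))

  node-layout : ∀ σ (s t : Slot (pre σ) (post σ)) → index s < index t →
    (Next s t × Crosses ⌞ node σ s ⌟ ⌞ node σ t ⌟) ⊎
    (suc (index s) < index t × Disjoint ⌞ node σ s ⌟ ⌞ node σ t ⌟)
  node-layout σ s t s<t with ℕ.m≤n⇒m<n∨m≡n s<t
  ... | inj₁ 1+s<t = inj₂ (1+s<t , inj₁ (ι-mono (nodeʳ<nodeˡ σ 1+s<t)))
  ... | inj₂ 1+s≡t = inj₁ (index⇒Next s t 1+s≡t ,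
          crosses-ι {node σ s} {node σ t} (nodeˡ-mono σ s<t)
            (subst (λ k → nodeˡ σ k < nodeʳ σ (index s)) 1+s≡t (ℕ.n<1+n _))
            (nodeʳ-mono σ s<t)
            (ℕ.+-monoʳ-< (base (toℕ σ)) s<t)
            (ℕ.+-monoʳ-< (base (toℕ σ)) (ℕ.+-monoʳ-< N (ℕ.∸-monoʳ-< s<t
              (ℕ.<⇒≤ (ℕ.<-trans (ℕ.n<1+n _) (ℕ.<-trans (ℕ.n<1+n _) (index<N t))))))))

  strips-disjoint : ∀ {σ σ′ s s′} → toℕ σ < toℕ σ′ → top (node σ s) < bottom (node σ′ s′)
  strips-disjoint {σ} {σ′} {s} σ<σ′ = ℕ.<-≤-trans
    (ℕ.≤-<-trans (ℕ.+-monoʳ-≤ (base (toℕ σ)) (ℕ.+-monoʳ-≤ N (ℕ.m∸n≤m N (index s))))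
      (base-mono σ<σ′))
    (ℕ.m≤m+n (base (toℕ σ′)) _)

  deeper-inside : ∀ {i j} → toℕ i < toℕ j → depth j < depth i → Inside ⌞ tall i ⌟ ⌞ tall j ⌟
  deeper-inside {i} {j} i<j dj<di = inside-ι {tall i} {tall j} dj<di (wall-mono {i} {j} i<j) dj<di
    (ℕ.+-monoʳ-< (base count) (ℕ.∸-monoʳ-< dj<di (depth≤2 i)))

  depth>0 : ∀ i → toℕ i < 2 → 0 < depth i
  depth>0 0F _ with linked
  ... | true = s≤s z≤n
  ... | false = s≤s z≤n
  depth>0 1F _ with linked
  ... | true = s≤s z≤n
  ... | false = s≤s z≤n
  depth>0 2F (s≤s (s≤s ()))

  link-layout : (linked ≡ true × Crosses ⌞ tall 0F ⌟ ⌞ tall 1F ⌟) ⊎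
    (linked ≡ false × Inside ⌞ tall 0F ⌟ ⌞ tall 1F ⌟)
  link-layout = by-cases linked refl
    where
    by-cases : ∀ l → linked ≡ l → (linked ≡ true × Crosses ⌞ tall 0F ⌟ ⌞ tall 1F ⌟) ⊎
      (linked ≡ false × Inside ⌞ tall 0F ⌟ ⌞ tall 1F ⌟)
    by-cases true on = inj₁ (on , crosses-ι {tall 0F} {tall 1F} d₀<d₁
      (ℕ.≤-<-trans (depth≤2 1F) (2<wall 0F)) (wall-mono {0F} {1F} (s≤s z≤n)) d₀<d₁
      (ℕ.+-monoʳ-< (base count) (ℕ.∸-monoʳ-< d₀<d₁ (depth≤2 1F))))
      where
      d₀<d₁ : depth 0F < depth 1F
      d₀<d₁ rewrite on = s≤s (s≤s z≤n)
    by-cases false off = inj₂ (off , deeper-inside {0F} {1F} (s≤s z≤n) d₁<d₀)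
      where
      d₁<d₀ : depth 1F < depth 0F
      d₁<d₀ rewrite off = s≤s (s≤s z≤n)

  LaidOut : Vertex → Vertex → Set
  LaidOut u v =
    (Adjacent u v × (Crosses (frame u) (frame v) ⊎ Crosses (frame v) (frame u))) ⊎
    (¬ Adjacent u v × Apart (frame u) (frame v))

  swap-Apart : ∀ {F G} → Apart F G → Apart G F
  swap-Apart (inj₁ p) = inj₂ (inj₁ p)
  swap-Apart (inj₂ (inj₁ p)) = inj₁ p
  swap-Apart (inj₂ (inj₂ (inj₁ p))) = inj₂ (inj₂ (inj₂ (inj₁ p)))
  swap-Apart (inj₂ (inj₂ (inj₂ (inj₁ p)))) = inj₂ (inj₂ (inj₁ p))
  swap-Apart (inj₂ (inj₂ (inj₂ (inj₂ (inj₁ p))))) = inj₂ (inj₂ (inj₂ (inj₂ (inj₂ p))))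
  swap-Apart (inj₂ (inj₂ (inj₂ (inj₂ (inj₂ p))))) = inj₂ (inj₂ (inj₂ (inj₂ (inj₁ p))))

  swap-LaidOut : ∀ {u v} → LaidOut u v → LaidOut v u
  swap-LaidOut (inj₁ (adj , c)) = inj₁ (swap adj , swap c)
  swap-LaidOut (inj₂ (¬adj , p)) = inj₂ (¬adj ∘ swap , swap-Apart p)

  tall-tall : ∀ i j → toℕ i < toℕ j → LaidOut (inj₁ i) (inj₁ j)
  tall-tall 0F 1F _ with link-layout
  ... | inj₁ (on , c) = inj₁ (inj₁ (bond on) , inj₁ c)
  ... | inj₂ (off , p) = inj₂
    ([ (λ { (bond on) → case trans (≡-sym off) on of λ () }) , (λ ()) ]′ , inj₁ p)
  tall-tall 0F 2F i<j = inj₂ ([ (λ ()) , (λ ()) ]′ ,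
    inj₁ (deeper-inside {0F} {2F} i<j (depth>0 0F (s≤s z≤n))))
  tall-tall 1F 2F i<j = inj₂ ([ (λ ()) , (λ ()) ]′ ,
    inj₁ (deeper-inside {1F} {2F} i<j (depth>0 1F ℕ.≤-refl)))
  tall-tall 1F 1F (s≤s ())
  tall-tall 2F 1F (s≤s ())
  tall-tall 2F 2F (s≤s (s≤s ()))

  tall-node : ∀ i σ s → LaidOut (inj₁ i) (inj₂ (σ , s))
  tall-node i σ s with Hit-layout i σ s
  ... | inj₁ (h , c) = inj₁ (inj₁ (hit i σ s h) , inj₁ c)
  ... | inj₂ (¬h , p) = inj₂ ([ (λ { (hit _ _ _ h) → ¬h h }) , (λ ()) ]′ , inj₂ p)

  node-node : ∀ σ s t → index s < index t → LaidOut (inj₂ (σ , s)) (inj₂ (σ , t))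
  node-node σ s t s<t with node-layout σ s t s<t
  ... | inj₁ (n , c) = inj₁ (inj₁ (next σ s t n) , inj₁ c)
  ... | inj₂ (1+s<t , p) = inj₂ ([ (λ { (next _ _ _ n) → ℕ.<⇒≢ 1+s<t (Next⇒index s t n) })
          , (λ { (next _ _ _ n) → ℕ.<-asym s<t (ℕ.≤-reflexive (Next⇒index t s n)) }) ]′ ,
          inj₂ (inj₂ p))

  node-node′ : ∀ {σ σ′} s t → toℕ σ < toℕ σ′ → LaidOut (inj₂ (σ , s)) (inj₂ (σ′ , t))
  node-node′ {σ} {σ′} s t σ<σ′ = inj₂
    ( [ (λ { (next _ _ _ _) → ℕ.<-irrefl refl σ<σ′ })
      , (λ { (next _ _ _ _) → ℕ.<-irrefl refl σ<σ′ }) ]′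
    , inj₂ (inj₂ (inj₂ (inj₂ (inj₁ (ι-mono (strips-disjoint {σ} {σ′} {s} {t} σ<σ′)))))))

  compare : ∀ u v → u ≡ v ⊎ LaidOut u v
  compare (inj₁ i) (inj₁ j) with ℕ.<-cmp (toℕ i) (toℕ j)
  ... | tri< i<j _ _ = inj₂ (tall-tall i j i<j)
  ... | tri≈ _ i≡j _ = inj₁ (cong inj₁ (toℕ-injective i≡j))
  ... | tri> _ _ j<i = inj₂ (swap-LaidOut (tall-tall j i j<i))
  compare (inj₁ i) (inj₂ (σ , s)) = inj₂ (tall-node i σ s)
  compare (inj₂ (σ , s)) (inj₁ i) = inj₂ (swap-LaidOut (tall-node i σ s))
  compare (inj₂ (σ , s)) (inj₂ (σ′ , t)) with ℕ.<-cmp (toℕ σ) (toℕ σ′)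
  ... | tri< σ<σ′ _ _ = inj₂ (node-node′ s t σ<σ′)
  ... | tri> _ _ σ′<σ = inj₂ (swap-LaidOut (node-node′ t s σ′<σ))
  ... | tri≈ _ σ≡σ′ _ with toℕ-injective σ≡σ′
  ...   | refl with ℕ.<-cmp (index s) (index t)
  ...     | tri< s<t _ _ = inj₂ (node-node σ s t s<t)
  ...     | tri≈ _ s≡t _ = inj₁ (cong (λ s → inj₂ (σ , s)) (index-injective s≡t))
  ...     | tri> _ _ t<s = inj₂ (swap-LaidOut (node-node σ t s t<s))

  -- Along a strip, left and right ends both increase, so nothing nests there. This settles
  -- condition (4) whenever a strip frame is crossed.
  node-empty : ∀ w {σ} (t : Slot (pre σ) (post σ)) → ¬ Inside (frame w) ⌞ node σ t ⌟
  node-empty (inj₁ i) {σ} t w⊂t = ℚ.<-asym (Inside.a>a w⊂t) (ι-mono (tall-left i σ t))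
  node-empty (inj₂ (σ′ , s)) {σ} t w⊂t with ℕ.<-cmp (toℕ σ′) (toℕ σ)
  ... | tri< σ′<σ _ _ = ℚ.<-asym (Inside.c>c w⊂t)
          (ℚ.<-trans (Frame.c<d ⌞ node σ′ s ⌟) (ι-mono (strips-disjoint {s = s} {t} σ′<σ)))
  ... | tri> _ _ σ<σ′ = ℚ.<-asym (Inside.d<d w⊂t)
          (ℚ.<-trans (ι-mono (strips-disjoint {s = t} {s} σ<σ′)) (Frame.c<d ⌞ node σ′ s ⌟))
  ... | tri≈ _ σ′≡σ _ with toℕ-injective σ′≡σ
  ...   | refl with ℕ.<-cmp (index s) (index t)
  ...     | tri< s<t _ _ = ℚ.<-asym (Inside.a>a w⊂t) (ι-mono (nodeˡ-mono σ s<t))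
  ...     | tri≈ _ s≡t _ = ℚ.<-irrefl (cong (ι ∘ nodeˡ σ) (≡-sym s≡t)) (Inside.a>a w⊂t)
  ...     | tri> _ _ t<s = ℚ.<-asym (Inside.b<b w⊂t) (ι-mono (nodeʳ-mono σ t<s))

  -- Every strip frame, even the first, extends beyond wall 0. Hence a crossing of tall frames 0 and
  -- 1 respects condition (4).
  innermost-empty : ∀ w → ¬ Inside (frame w) ⌞ tall 0F ⌟
  innermost-empty (inj₁ 0F) w⊂ = ℚ.<-irrefl refl (Inside.b<b w⊂)
  innermost-empty (inj₁ 1F) w⊂ = ℚ.<-asym (Inside.b<b w⊂) (ι-mono (wall-mono {0F} {1F} (s≤s z≤n)))
  innermost-empty (inj₁ 2F) w⊂ = ℚ.<-asym (Inside.b<b w⊂) (ι-mono (wall-mono {0F} {2F} (s≤s z≤n)))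
  innermost-empty (inj₂ (σ , s)) w⊂ = ℚ.<-asym (Inside.b<b w⊂)
    (ι-mono (wall<nodeʳ 0F σ s (ℕ.≤-trans (τ₀≤1 σ) (s≤s z≤n))))

  tall-crosses-tall : ∀ i j → Crosses ⌞ tall i ⌟ ⌞ tall j ⌟ → i ≡ 0F
  tall-crosses-tall 0F _ _ = refl
  tall-crosses-tall 1F 0F i→j = contradiction (Crosses.b<b i→j)
    (ℚ.<-asym (ι-mono (wall-mono {0F} {1F} (s≤s z≤n))))
  tall-crosses-tall 2F 0F i→j = contradiction (Crosses.b<b i→j)
    (ℚ.<-asym (ι-mono (wall-mono {0F} {2F} (s≤s z≤n))))
  tall-crosses-tall 2F 1F i→j = contradiction (Crosses.b<b i→j)
    (ℚ.<-asym (ι-mono (wall-mono {1F} {2F} ℕ.≤-refl)))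
  tall-crosses-tall 1F 1F i→j = contradiction (Crosses.b<b i→j) (ℚ.<-irrefl refl)
  tall-crosses-tall 2F 2F i→j = contradiction (Crosses.b<b i→j) (ℚ.<-irrefl refl)
  tall-crosses-tall 1F 2F i→j =
    contradiction (Crosses.a<a i→j) (ℚ.<-asym (ι-mono (depth>0 1F ℕ.≤-refl)))

  Arc-irrefl : ∀ {u} → ¬ Arc u u
  Arc-irrefl (next _ s _ n) = ℕ.1+n≢n (Next⇒index s s n)

  graph : Graph
  graph = record { V = Vertex ; Adj = Adjacent ; sym = swap ; irrfl = [ Arc-irrefl , Arc-irrefl ]′ }

  no-common : ∀ u v w → Crosses (frame u) (frame v) →
    Inside (frame w) (frame u) → ¬ Inside (frame w) (frame v)
  no-common u (inj₂ (σ , t)) w _ _ w⊂v = node-empty w t w⊂v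
  no-common (inj₂ (σ , s)) (inj₁ j) w u→v _ _ =
    ℚ.<-asym (Crosses.a<a u→v) (ι-mono (tall-left j σ s))
  no-common (inj₁ i) (inj₁ j) w u→v w⊂u _ with tall-crosses-tall i j u→v
  ... | refl = innermost-empty w w⊂u

  distinct⇒LaidOut : ∀ {u v} → u ≢ v → LaidOut u v
  distinct⇒LaidOut {u} {v} u≢v with compare u v
  ... | inj₁ u≡v = contradiction u≡v u≢v
  ... | inj₂ l = l

  layout : Layout graph
  layout = record
    { frame = frame
    ; layout = distinct⇒LaidOut
    ; no-common = λ {u} {v} {w} → no-common u v w }

  ≡-or-≢ : ∀ u v → u ≡ v ⊎ u ≢ v
  ≡-or-≢ u v with compare u v
  ... | inj₁ u≡v = inj₁ u≡v
  ... | inj₂ (inj₁ (adj , _)) = inj₂ λ { refl → irrfl graph adj }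
  ... | inj₂ (inj₂ (_ , apart)) = inj₂ λ { refl → ¬self-apart apart }
    where
    ¬self-apart : ∀ {F} → ¬ Apart F F
    ¬self-apart {F} p = Apart⇒¬Meet p
      (_ , Corner⊆OnFrame F _ (inj₁ refl , inj₁ refl) , Corner⊆OnFrame F _ (inj₁ refl , inj₁ refl))

  representation : RestrictedFrameRep graph
  representation = Layout⇒Rep layout ≡-or-≢

-- Induced subgraphs

-- A left inverse is enough to pass representations along, as restricted frame graphs are closed
-- under induced subgraphs; `from-adj` makes `to` reflect adjacency.
record _↪_ (G H : Graph) : Set where
  field
    to : V G → V H
    from : V H → V G
    to-adj : ∀ {u v} → Adj G u v → Adj H (to u) (to v)
    from-adj : ∀ {u v} → Adj H u v → Adj G (from u) (from v)
    from-to : ∀ u → from (to u) ≡ u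

  to-injective : ∀ {u v} → u ≢ v → to u ≢ to v
  to-injective {u} {v} u≢v eq = u≢v (trans (≡-sym (from-to u)) (trans (cong from eq) (from-to v)))

  to-adj⁻¹ : ∀ {u v} → Adj H (to u) (to v) → Adj G u v
  to-adj⁻¹ adj = subst id (cong₂ (Adj G) (from-to _) (from-to _)) (from-adj adj)

restrict : ∀ {G H} → G ↪ H → RestrictedFrameRep H → RestrictedFrameRep G
restrict G↪H R = record
  { F = F ∘ to
  ; adj⇔meet = λ u v u≢v → let e = adj⇔meet _ _ (to-injective u≢v) in
      mk⇔ (Equivalence.to e ∘ to-adj) (to-adj⁻¹ ∘ Equivalence.from e)
  ; cond1 = λ u v u≢v → cond1 _ _ (to-injective u≢v)
  ; cond2 = λ u v u≢v → cond2 _ _ (to-injective u≢v)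
  ; cond3 = λ u v u≢v → cond3 _ _ (to-injective u≢v)
  ; cond4 = λ u v u≢v meet w → cond4 _ _ (to-injective u≢v) meet (to w)
  }
  where
  open RestrictedFrameRep R
  open _↪_ G↪H

-- The two patterns of subdivided edges realised by strips

module _ {A : Set} where

  values : (x₀ x₁ x₂ x₃ x₄ x₅ : A) → Fin 6 → A
  values x₀ x₁ x₂ x₃ x₄ x₅ 0F = x₀
  values x₀ x₁ x₂ x₃ x₄ x₅ 1F = x₁
  values x₀ x₁ x₂ x₃ x₄ x₅ 2F = x₂
  values x₀ x₁ x₂ x₃ x₄ x₅ 3F = x₃
  values x₀ x₁ x₂ x₃ x₄ x₅ 4F = x₄
  values x₀ x₁ x₂ x₃ x₄ x₅ 5F = x₅

  -- Pointwise equal to `f` but given by its six entries, so that statements about `values` apply to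
  -- it.
  reify : (Fin 6 → A) → Fin 6 → A
  reify f = values (f 0F) (f 1F) (f 2F) (f 3F) (f 4F) (f 5F)

  reify-≗ : ∀ f e → reify f e ≡ f e
  reify-≗ f 0F = refl
  reify-≗ f 1F = refl
  reify-≗ f 2F = refl
  reify-≗ f 3F = refl
  reify-≗ f 4F = refl
  reify-≗ f 5F = refl

-- The edges 01 and 02 are kept, 03 and 12 are subdivided. The strips are 1 followed by the path
-- to 3, the path from 1 to 2 (without its first vertex) followed by 2 and the path to 3, and the
-- path from 0 to 3. The first vertex of the path from 1 to 2, 0 and 3 are the tall frames.
module Path (p q r s : ℕ) where

  strips : Strips
  strips = record
    { count = 3
    ; pre = λ { 0F → 0 ; 1F → q ; 2F → 0 }
    ; post = λ { 0F → r ; 1F → s ; 2F → p }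
    -- Wall 0 belongs to the first vertex of the path from 1 to 2, which has no neighbour inside the
    -- path from 0 to 3.
    ; active = λ { 0F → true ; 1F → true ; 2F → false }
    ; linked = false }

  open Strips strips using (Vertex; Arc; hit; next; bond; graph)

  len = values 0 0 (suc p) (suc q) r s

  to : SubV len → Vertex
  to (inj₁ 0F) = inj₁ 1F
  to (inj₁ 1F) = inj₂ (0F , middle)
  to (inj₁ 2F) = inj₂ (1F , middle)
  to (inj₁ 3F) = inj₁ 2F
  to (inj₂ (2F , zero)) = inj₂ (2F , middle)
  to (inj₂ (2F , suc k)) = inj₂ (2F , after k)
  to (inj₂ (3F , zero)) = inj₁ 0F
  to (inj₂ (3F , suc k)) = inj₂ (1F , before k)
  to (inj₂ (4F , k)) = inj₂ (0F , after k)
  to (inj₂ (5F , k)) = inj₂ (1F , after k)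

  from : Vertex → SubV len
  from (inj₁ 0F) = inj₂ (3F , zero)
  from (inj₁ 1F) = inj₁ 0F
  from (inj₁ 2F) = inj₁ 3F
  from (inj₂ (0F , middle)) = inj₁ 1F
  from (inj₂ (0F , after k)) = inj₂ (4F , k)
  from (inj₂ (1F , before k)) = inj₂ (3F , suc k)
  from (inj₂ (1F , middle)) = inj₁ 2F
  from (inj₂ (1F , after k)) = inj₂ (5F , k)
  from (inj₂ (2F , middle)) = inj₂ (2F , zero)
  from (inj₂ (2F , after k)) = inj₂ (2F , suc k)

  from-to : ∀ u → from (to u) ≡ u
  from-to (inj₁ 0F) = refl
  from-to (inj₁ 1F) = refl
  from-to (inj₁ 2F) = refl
  from-to (inj₁ 3F) = refl
  from-to (inj₂ (2F , zero)) = refl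
  from-to (inj₂ (2F , suc k)) = refl
  from-to (inj₂ (3F , zero)) = refl
  from-to (inj₂ (3F , suc k)) = refl
  from-to (inj₂ (4F , k)) = refl
  from-to (inj₂ (5F , k)) = refl

  to-arc : ∀ {u v} → SubArc len u v → Arc (to u) (to v) ⊎ Arc (to v) (to u)
  to-arc (direct 0F _) = inj₁ (hit 1F 0F middle refl)
  to-arc (direct 1F _) = inj₁ (hit 1F 1F middle refl)
  to-arc (direct 4F eq) = inj₂ (hit 2F 0F middle eq)
  to-arc (direct 5F eq) = inj₂ (hit 2F 1F middle eq)
  to-arc (first 2F zero _) = inj₁ (hit 1F 2F middle refl)
  to-arc (first 3F zero _) = inj₂ (hit 0F 0F middle (refl , refl))
  to-arc (first 4F k eq) = inj₁ (next 0F middle (after k) eq)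
  to-arc (first 5F k eq) = inj₁ (next 1F middle (after k) eq)
  to-arc (last 2F zero eq) = inj₂ (hit 2F 2F middle (≡-sym (ℕ.suc-injective eq)))
  to-arc (last 2F (suc k) eq) = inj₂ (hit 2F 2F (after k) (ℕ.suc-injective eq))
  to-arc (last 3F zero eq) = inj₁ (hit 0F 1F middle (refl , ≡-sym (ℕ.suc-injective eq)))
  to-arc (last 3F (suc k) eq) = inj₁ (next 1F (before k) middle (ℕ.suc-injective eq))
  to-arc (last 4F k eq) = inj₂ (hit 2F 0F (after k) eq)
  to-arc (last 5F k eq) = inj₂ (hit 2F 1F (after k) eq)
  to-arc (step 2F zero (suc k′) eq) = inj₁ (next 2F middle (after k′) (≡-sym (ℕ.suc-injective eq)))
  to-arc (step 2F (suc k) (suc k′) eq) = inj₁ (next 2F (after k) (after k′) (ℕ.suc-injective eq))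
  to-arc (step 3F zero (suc k′) eq) =
    inj₁ (hit 0F 1F (before k′) (refl , ≡-sym (ℕ.suc-injective eq)))
  to-arc (step 3F (suc k) (suc k′) eq) = inj₁ (next 1F (before k) (before k′) (ℕ.suc-injective eq))
  to-arc (step 4F k k′ eq) = inj₁ (next 0F (after k) (after k′) eq)
  to-arc (step 5F k k′ eq) = inj₁ (next 1F (after k) (after k′) eq)

  from-arc : ∀ {u v} → Arc u v → SubAdj len (from u) (from v)
  from-arc (hit 0F 0F middle _) = inj₂ (first 3F zero refl)
  from-arc (hit 0F 1F (before k) h) = inj₁ (step 3F zero (suc k) (cong suc (≡-sym (proj₂ h))))
  from-arc (hit 0F 1F middle h) = inj₁ (last 3F zero (cong suc (≡-sym (proj₂ h))))
  from-arc (hit 0F 2F _ (() , _))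
  from-arc (hit 1F 0F middle _) = inj₁ (direct 0F refl)
  from-arc (hit 1F 1F middle _) = inj₁ (direct 1F refl)
  from-arc (hit 1F 2F middle _) = inj₁ (first 2F zero refl)
  from-arc (hit 2F 0F middle eq) = inj₂ (direct 4F eq)
  from-arc (hit 2F 0F (after k) eq) = inj₂ (last 4F k eq)
  from-arc (hit 2F 1F middle eq) = inj₂ (direct 5F eq)
  from-arc (hit 2F 1F (after k) eq) = inj₂ (last 5F k eq)
  from-arc (hit 2F 2F middle eq) = inj₂ (last 2F zero (cong suc (≡-sym eq)))
  from-arc (hit 2F 2F (after k) eq) = inj₂ (last 2F (suc k) (cong suc eq))
  from-arc (next 0F middle (after k) eq) = inj₁ (first 4F k eq)
  from-arc (next 0F (after k) (after k′) eq) = inj₁ (step 4F k k′ eq)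
  from-arc (next 1F (before k) (before k′) eq) = inj₁ (step 3F (suc k) (suc k′) (cong suc eq))
  from-arc (next 1F (before k) middle eq) = inj₁ (last 3F (suc k) (cong suc eq))
  from-arc (next 1F middle (after k) eq) = inj₁ (first 5F k eq)
  from-arc (next 1F (after k) (after k′) eq) = inj₁ (step 5F k k′ eq)
  from-arc (next 2F middle (after k) eq) = inj₁ (step 2F zero (suc k) (cong suc (≡-sym eq)))
  from-arc (next 2F (after k) (after k′) eq) = inj₁ (step 2F (suc k) (suc k′) (cong suc eq))
  from-arc (bond ())

  embedding : Sub len ↪ graph
  embedding = record
    { to = to ; from = from
    ; to-adj = [ to-arc , swap ∘ to-arc ]′
    ; from-adj = [ from-arc , swap ∘ from-arc ]′
    ; from-to = from-to }

-- The edges at 0 are kept and the others are subdivided. The strips are the path from 1 to 2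
-- followed by 2 and the path to 3 (without its last vertex), and the path from 1 to 3 followed
-- by 3. The tall frames are 1, 0 and the last vertex of the path from 2 to 3.
module Star (q r s : ℕ) where

  strips : Strips
  strips = record
    { count = 2
    ; pre = λ { 0F → suc q ; 1F → suc s }
    -- With nothing after the middle, walls 1 and 2 both hit the frame of 3, which is adjacent to 0
    -- and to the last vertex of the path from 2 to 3.
    ; post = λ { 0F → r ; 1F → 0 }
    ; active = λ _ → true
    ; linked = true }

  open Strips strips using (Vertex; Arc; hit; next; bond; graph)

  len = values 0 0 0 (suc q) (suc s) (suc r)

  -- The last of the `suc r` vertices becomes a tall frame; the other `r` fill the strip after 2.
  to-last : Fin (suc r) → Vertex
  to-last k with view k
  ... | ‵fromℕ = inj₁ 2F
  ... | ‵inject₁ k = inj₂ (0F , after k)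

  to : SubV len → Vertex
  to (inj₁ 0F) = inj₁ 1F
  to (inj₁ 1F) = inj₁ 0F
  to (inj₁ 2F) = inj₂ (0F , middle)
  to (inj₁ 3F) = inj₂ (1F , middle)
  to (inj₂ (3F , k)) = inj₂ (0F , before k)
  to (inj₂ (4F , k)) = inj₂ (1F , before k)
  to (inj₂ (5F , k)) = to-last k

  from : Vertex → SubV len
  from (inj₁ 0F) = inj₁ 1F
  from (inj₁ 1F) = inj₁ 0F
  from (inj₁ 2F) = inj₂ (5F , fromℕ r)
  from (inj₂ (0F , before k)) = inj₂ (3F , k)
  from (inj₂ (0F , middle)) = inj₁ 2F
  from (inj₂ (0F , after k)) = inj₂ (5F , inject₁ k)
  from (inj₂ (1F , before k)) = inj₂ (4F , k)
  from (inj₂ (1F , middle)) = inj₁ 3F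

  from-to : ∀ u → from (to u) ≡ u
  from-to (inj₁ 0F) = refl
  from-to (inj₁ 1F) = refl
  from-to (inj₁ 2F) = refl
  from-to (inj₁ 3F) = refl
  from-to (inj₂ (3F , k)) = refl
  from-to (inj₂ (4F , k)) = refl
  from-to (inj₂ (5F , k)) with view k
  ... | ‵fromℕ = refl
  ... | ‵inject₁ k = refl

  to-arc : ∀ {u v} → SubArc len u v → Arc (to u) (to v) ⊎ Arc (to v) (to u)
  to-arc (direct 0F _) = inj₂ (bond refl)
  to-arc (direct 1F _) = inj₁ (hit 1F 0F middle refl)
  to-arc (direct 2F _) = inj₁ (hit 1F 1F middle refl)
  to-arc (direct 3F ())
  to-arc (direct 4F ())
  to-arc (direct 5F ())
  to-arc (first 3F k eq) = inj₁ (hit 0F 0F (before k) (refl , eq))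
  to-arc (first 4F k eq) = inj₁ (hit 0F 1F (before k) (refl , eq))
  to-arc (first 5F k eq) with view k
  ... | ‵fromℕ = inj₂ (hit 2F 0F middle (trans (≡-sym (toℕ-fromℕ r)) eq))
  ... | ‵inject₁ k = inj₁ (next 0F middle (after k) (trans (≡-sym (toℕ-inject₁ k)) eq))
  to-arc (last 3F k eq) = inj₁ (next 0F (before k) middle eq)
  to-arc (last 4F k eq) = inj₁ (next 1F (before k) middle eq)
  to-arc (last 5F k eq) with view k
  ... | ‵fromℕ = inj₁ (hit 2F 1F middle refl)
  ... | ‵inject₁ k = contradiction (trans (≡-sym (toℕ-inject₁ k)) (ℕ.suc-injective eq))
          (ℕ.<⇒≢ (toℕ<n k))
  to-arc (step 3F k k′ eq) = inj₁ (next 0F (before k) (before k′) eq)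
  to-arc (step 4F k k′ eq) = inj₁ (next 1F (before k) (before k′) eq)
  to-arc (step 5F k k′ eq) with view k | view k′
  ... | ‵fromℕ | _ = contradiction (trans (cong suc (≡-sym (toℕ-fromℕ r))) eq)
          (≢-sym (ℕ.<⇒≢ (toℕ<n k′)))
  ... | ‵inject₁ k | ‵fromℕ = inj₂ (hit 2F 0F (after k)
          (trans (cong suc (≡-sym (toℕ-inject₁ k))) (trans eq (toℕ-fromℕ r))))
  ... | ‵inject₁ k | ‵inject₁ k′ = inj₁ (next 0F (after k) (after k′)
          (trans (cong suc (≡-sym (toℕ-inject₁ k))) (trans eq (toℕ-inject₁ k′))))

  from-arc : ∀ {u v} → Arc u v → SubAdj len (from u) (from v)
  from-arc (hit 0F 0F (before k) h) = inj₁ (first 3F k (proj₂ h))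
  from-arc (hit 0F 1F (before k) h) = inj₁ (first 4F k (proj₂ h))
  from-arc (hit 1F 0F middle _) = inj₁ (direct 1F refl)
  from-arc (hit 1F 1F middle _) = inj₁ (direct 2F refl)
  from-arc (hit 2F 0F middle eq) = inj₂ (first 5F (fromℕ r) (trans (toℕ-fromℕ r) eq))
  from-arc (hit 2F 0F (after k) eq) = inj₂ (step 5F (inject₁ k) (fromℕ r)
    (trans (cong suc (toℕ-inject₁ k)) (trans eq (≡-sym (toℕ-fromℕ r)))))
  from-arc (hit 2F 1F middle _) = inj₁ (last 5F (fromℕ r) (cong suc (toℕ-fromℕ r)))
  from-arc (next 0F (before k) (before k′) eq) = inj₁ (step 3F k k′ eq)
  from-arc (next 0F (before k) middle eq) = inj₁ (last 3F k eq)
  from-arc (next 0F middle (after k) eq) = inj₁ (first 5F (inject₁ k) (trans (toℕ-inject₁ k) eq))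
  from-arc (next 0F (after k) (after k′) eq) = inj₁ (step 5F (inject₁ k) (inject₁ k′)
    (trans (cong suc (toℕ-inject₁ k)) (trans eq (≡-sym (toℕ-inject₁ k′)))))
  from-arc (next 1F (before k) (before k′) eq) = inj₁ (step 4F k k′ eq)
  from-arc (next 1F (before k) middle eq) = inj₁ (last 4F k eq)
  from-arc (bond _) = inj₂ (direct 0F refl)

  embedding : Sub len ↪ graph
  embedding = record
    { to = to ; from = from
    ; to-adj = [ to-arc , swap ∘ to-arc ]′
    ; from-adj = [ from-arc , swap ∘ from-arc ]′
    ; from-to = from-to }

-- Relabelling by permutations of the branch vertices

module _ {n : ℕ} where

  opposite-first : (k : Fin n) → toℕ k ≡ 0 → suc (toℕ (opposite k)) ≡ n
  opposite-first k eq = trans (cong suc (trans (opposite-prop k) (cong (λ m → n ∸ suc m) eq)))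
    (ℕ.m+[n∸m]≡n (ℕ.≤-trans (s≤s z≤n) (toℕ<n k)))

  opposite-last : (k : Fin n) → suc (toℕ k) ≡ n → toℕ (opposite k) ≡ 0
  opposite-last k eq = trans (opposite-prop k) (trans (cong (n ∸_) eq) (ℕ.n∸n≡0 n))

  opposite-step : (k k′ : Fin n) → suc (toℕ k) ≡ toℕ k′ → suc (toℕ (opposite k′)) ≡ toℕ (opposite k)
  opposite-step k k′ eq = trans (cong suc (opposite-prop k′))
    (trans (≡-sym (ℕ.+-∸-assoc 1 (toℕ<n k′))) (≡-sym (trans (opposite-prop k) (cong (n ∸_) eq))))

opposite-cast-opposite : ∀ {m n} (eq : m ≡ n) (k : Fin m) →
  toℕ (opposite (cast eq (opposite k))) ≡ toℕ k
opposite-cast-opposite refl k = cong toℕ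
  (trans (cong opposite (cast-is-id refl (opposite k))) (opposite-involutive k))

toℕ-cong-inner : ∀ {len : Fin 6 → ℕ} {e e′ k k′} → e ≡ e′ → toℕ k ≡ toℕ k′ →
  _≡_ {A = SubV len} (inj₂ (e , k)) (inj₂ (e′ , k′))
toℕ-cong-inner {e = e} refl eq = cong (λ k → inj₂ (e , k)) (toℕ-injective eq)

module _ (σ : Permutation′ 4) where

  image : Fin 6 → Fin 6
  image e = link (σ ⟨$⟩ʳ src e) (σ ⟨$⟩ʳ tgt e)

  image-joins : ∀ e → Joins (image e) (σ ⟨$⟩ʳ src e) (σ ⟨$⟩ʳ tgt e)
  image-joins e = link-joins _ _ λ eq → src≢tgt e
    (trans (≡-sym (inverseˡ σ)) (trans (cong (σ ⟨$⟩ˡ_) eq) (inverseˡ σ)))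

  image-inverse : ∀ e → link (σ ⟨$⟩ˡ src (image e)) (σ ⟨$⟩ˡ tgt (image e)) ≡ e
  image-inverse e with image-joins e
  ... | inj₁ (s , t) = joins-link e _ _ (inj₁ (back s , back t))
    where
    back : ∀ {i j} → i ≡ σ ⟨$⟩ʳ j → j ≡ σ ⟨$⟩ˡ i
    back eq = ≡-sym (trans (cong (σ ⟨$⟩ˡ_) eq) (inverseˡ σ))
  ... | inj₂ (s , t) = joins-link e _ _ (inj₂ (back t , back s))
    where
    back : ∀ {i j} → i ≡ σ ⟨$⟩ʳ j → j ≡ σ ⟨$⟩ˡ i
    back eq = ≡-sym (trans (cong (σ ⟨$⟩ˡ_) eq) (inverseˡ σ))

module Relabel {len len′ : Fin 6 → ℕ} (σ : Permutation′ 4)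
  (len-image : ∀ e → len e ≡ len′ (image σ e)) where

  -- Every edge of K₄ is directed from its smaller end; where `σ` reverses this direction, the path
  -- is reversed too.
  place : ∀ {e} → Joins (image σ e) (σ ⟨$⟩ʳ src e) (σ ⟨$⟩ʳ tgt e) →
    Fin (len e) → Fin (len′ (image σ e))
  place {e} (inj₁ _) k = cast (len-image e) k
  place {e} (inj₂ _) k = cast (len-image e) (opposite k)

  relabel : SubV len → SubV len′
  relabel (inj₁ i) = inj₁ (σ ⟨$⟩ʳ i)
  relabel (inj₂ (e , k)) = inj₂ (image σ e , place (image-joins σ e) k)

  to-first : ∀ {e i} k → src e ≡ i → toℕ k ≡ 0 → SubArc len′ (inj₁ i) (inj₂ (e , k))
  to-first k refl eq = first _ k eq

  to-last : ∀ {e i} k → tgt e ≡ i → suc (toℕ k) ≡ len′ e → SubArc len′ (inj₂ (e , k)) (inj₁ i)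
  to-last k refl eq = last _ k eq

  to-direct : ∀ {e i j} → Joins e i j → len′ e ≡ 0 → SubAdj len′ (inj₁ i) (inj₁ j)
  to-direct (inj₁ (refl , refl)) eq = inj₁ (direct _ eq)
  to-direct (inj₂ (refl , refl)) eq = inj₂ (direct _ eq)

  relabel-arc : ∀ {u v} → SubArc len u v → SubAdj len′ (relabel u) (relabel v)
  relabel-arc (direct e eq) = to-direct (image-joins σ e) (trans (≡-sym (len-image e)) eq)
  relabel-arc (first e k eq) with image-joins σ e
  ... | inj₁ (s , _) = inj₁ (to-first _ s (trans (toℕ-cast _ k) eq))
  ... | inj₂ (_ , t) = inj₂ (to-last _ t
          (trans (cong suc (toℕ-cast _ (opposite k))) (trans (opposite-first k eq) (len-image e))))
  relabel-arc (last e k eq) with image-joins σ e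
  ... | inj₁ (_ , t) = inj₁ (to-last _ t
          (trans (cong suc (toℕ-cast _ k)) (trans eq (len-image e))))
  ... | inj₂ (s , _) = inj₂ (to-first _ s (trans (toℕ-cast _ (opposite k)) (opposite-last k eq)))
  relabel-arc (step e k k′ eq) with image-joins σ e
  ... | inj₁ _ = inj₁ (step _ _ _ (trans (cong suc (toℕ-cast _ k))
          (trans eq (≡-sym (toℕ-cast _ k′)))))
  ... | inj₂ _ = inj₂ (step _ _ _ (trans (cong suc (toℕ-cast _ (opposite k′)))
          (trans (opposite-step k k′ eq) (≡-sym (toℕ-cast _ (opposite k))))))

  relabel-adj : ∀ {u v} → SubAdj len u v → SubAdj len′ (relabel u) (relabel v)
  relabel-adj = [ relabel-arc , swap ∘ relabel-arc ]′

module _ {len len′ : Fin 6 → ℕ} (σ : Permutation′ 4)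
  (len-image : ∀ e → len e ≡ len′ (image σ e)) where

  private
    σ⁻¹ = Perm.flip σ

    len-preimage : ∀ e → len′ e ≡ len (image σ⁻¹ e)
    len-preimage e = ≡-sym (trans (len-image (image σ⁻¹ e)) (cong len′ (image-inverse σ⁻¹ e)))

    module there = Relabel {len} {len′} σ len-image
    module back = Relabel {len′} {len} σ⁻¹ len-preimage

  back-there : ∀ u → back.relabel (there.relabel u) ≡ u
  back-there (inj₁ i) = cong inj₁ (inverseˡ σ)
  back-there (inj₂ (e , k)) = toℕ-cong-inner (image-inverse σ e)
    (same-place (image-joins σ e) (image-joins σ⁻¹ (image σ e)))
    where
    unmap : ∀ {i j} → i ≡ σ ⟨$⟩ʳ j → σ ⟨$⟩ˡ i ≡ j
    unmap eq = trans (cong (σ ⟨$⟩ˡ_) eq) (inverseˡ σ)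
    same-place : ∀ j j′ → toℕ (back.place j′ (there.place j k)) ≡ toℕ k
    same-place (inj₁ _) (inj₁ _) =
      trans (toℕ-cast (len-preimage _) (cast (len-image e) k)) (toℕ-cast (len-image e) k)
    same-place (inj₂ _) (inj₂ _) = trans
      (toℕ-cast (len-preimage _) (opposite (cast (len-image e) (opposite k))))
      (opposite-cast-opposite (len-image e) k)
    -- `σ` and its inverse reverse corresponding edges; mixed directions would identify the ends of
    -- `e`.
    same-place (inj₁ (s , _)) (inj₂ (_ , t′)) = contradiction
      (trans (≡-sym (unmap s)) (trans (≡-sym t′) (cong tgt (image-inverse σ e)))) (src≢tgt e)
    same-place (inj₂ (s , _)) (inj₁ (s′ , _)) = contradiction
      (trans (≡-sym (cong src (image-inverse σ e))) (trans s′ (unmap s))) (src≢tgt e)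

  relabelling : Sub len ↪ Sub len′
  relabelling = record
    { to = there.relabel ; from = back.relabel
    ; to-adj = there.relabel-adj ; from-adj = back.relabel-adj
    ; from-to = back-there }

-- Reduction to 01 and 02 unsubdivided

TriangleFree-pull : ∀ {G H} (f : V G → V H) → (∀ {u v} → Adj G u v → Adj H (f u) (f v)) →
  TriangleFree H → TriangleFree G
TriangleFree-pull f hom tf (x , y , z , x~y , y~z , x~z) =
  tf (f x , f y , f z , hom x~y , hom y~z , hom x~z)

-- Three patterns contain one of the triangles 012, 013 and 023; the remaining two are those of
-- `Path` and `Star`.
standard-representation : ∀ {l₀ l₁ l₂ l₃ l₄ l₅} → l₀ ≡ 0 → l₁ ≡ 0 →
  TriangleFree (Sub (values l₀ l₁ l₂ l₃ l₄ l₅)) →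
  RestrictedFrameRep (Sub (values l₀ l₁ l₂ l₃ l₄ l₅))
standard-representation {l₃ = zero} refl refl tf = contradiction
  (inj₁ 0F , inj₁ 1F , inj₁ 2F ,
   inj₁ (direct 0F refl) , inj₁ (direct 3F refl) , inj₁ (direct 1F refl)) tf
standard-representation {l₂ = suc p} {l₃ = suc q} {r} {s} refl refl _ =
  restrict (Path.embedding p q r s) (Strips.representation (Path.strips p q r s))
standard-representation {l₂ = zero} {suc q} {zero} refl refl tf = contradiction
  (inj₁ 0F , inj₁ 1F , inj₁ 3F ,
   inj₁ (direct 0F refl) , inj₁ (direct 4F refl) , inj₁ (direct 2F refl)) tf
standard-representation {l₂ = zero} {suc q} {suc s} {zero} refl refl tf = contradiction
  (inj₁ 0F , inj₁ 2F , inj₁ 3F ,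
   inj₁ (direct 1F refl) , inj₁ (direct 5F refl) , inj₁ (direct 2F refl)) tf
standard-representation {l₂ = zero} {suc q} {suc s} {suc r} refl refl _ =
  restrict (Star.embedding q r s) (Strips.representation (Star.strips q r s))

AdjacentFlatEdges : (Fin 6 → ℕ) → Set
AdjacentFlatEdges len = Σ (Fin 6) λ e → Σ (Fin 6) λ e′ →
  e ≢ e′ × len e ≡ 0 × len e′ ≡ 0 × ShareVertex e e′

-- A family of permutations that is easy to search and, as `standardise` checks, rich enough to
-- bring any two adjacent edges to 01 and 02.
moves-to : (i j k : Fin 4) → Permutation′ 4
moves-to i j k = transpose 0F i ∘ₚ transpose 1F j ∘ₚ transpose 2F k

StandardAt : Permutation′ 4 → Fin 6 → Fin 6 → Set
StandardAt σ e e′ = image (Perm.flip σ) 0F ≡ e × image (Perm.flip σ) 1F ≡ e′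

standardAt? : ∀ σ e e′ → Dec (StandardAt σ e e′)
standardAt? σ e e′ = image (Perm.flip σ) 0F ≟ᶠ e ×-dec image (Perm.flip σ) 1F ≟ᶠ e′

abstract
  standardise : ∀ e e′ → e ≢ e′ → ShareVertex e e′ →
    Σ (Fin 4) λ i → Σ (Fin 4) λ j → Σ (Fin 4) λ k → StandardAt (moves-to i j k) e e′
  standardise = from-yes (all? λ e → all? λ e′ → ¬? (e ≟ᶠ e′) →-dec shareVertex? e e′ →-dec
      any? λ i → any? λ j → any? λ k → standardAt? (moves-to i j k) e e′)

adjacentFlatEdges⇒representation : ∀ {len} → TriangleFree (Sub len) → AdjacentFlatEdges len →
  RestrictedFrameRep (Sub len)
adjacentFlatEdges⇒representation {len} tf (e , e′ , e≢e′ , flat , flat′ , share)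
  with standardise e e′ e≢e′ share
... | i , j , k , eq , eq′ = restrict iso (standard-representation (trans (cong len eq) flat)
        (trans (cong len eq′) flat′)
        (TriangleFree-pull {Sub len′} {Sub len} (_↪_.from iso) (_↪_.from-adj iso) tf))
  where
  σ = moves-to i j k
  σ⁻¹ = Perm.flip σ
  len′ = reify (len ∘ image σ⁻¹)
  iso : Sub len ↪ Sub len′
  iso = relabelling σ λ e → ≡-sym
    (trans (reify-≗ (len ∘ image σ⁻¹) (image σ e)) (cong len (image-inverse σ e)))

-- Counting subdivided edges

∀Bool? : {P : Bool → Set} → (∀ b → Dec (P b)) → Dec (∀ b → P b)
∀Bool? P? = map′ (λ { (f , t) false → f ; (f , t) true → t }) (λ f → f false , f true)
  (P? false ×-dec P? true)

-- Functions enter through their six values, which turns a statement about all patterns of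
-- subdivided edges into 64 cases to decide.
∀Values : ((Fin 6 → Bool) → Set) → Set
∀Values P = ∀ b₀ b₁ b₂ b₃ b₄ b₅ → P (values b₀ b₁ b₂ b₃ b₄ b₅)

∀Values? : {P : (Fin 6 → Bool) → Set} → (∀ b → Dec (P b)) → Dec (∀Values P)
∀Values? P? = ∀Bool? λ _ → ∀Bool? λ _ → ∀Bool? λ _ → ∀Bool? λ _ → ∀Bool? λ _ → ∀Bool? λ _ → P? _

at : {P : (Fin 6 → Bool) → Set} → ∀Values P → ∀ b → P (reify b)
at p b = p _ _ _ _ _ _

count : (Fin 6 → Bool) → ℕ
count b = length (filter (T? ∘ b) (allFin 6))

length-filter-cong : ∀ {A : Set} {P Q : A → Set} (P? : Decidable P) (Q? : Decidable Q) →
  (∀ x → does (P? x) ≡ does (Q? x)) → ∀ xs → length (filter P? xs) ≡ length (filter Q? xs)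
length-filter-cong P? Q? eq [] = refl
length-filter-cong P? Q? eq (x ∷ xs) with does (P? x) | does (Q? x) | eq x
... | false | .false | refl = length-filter-cong P? Q? eq xs
... | true | .true | refl = cong suc (length-filter-cong P? Q? eq xs)

AdjacentFalse : (Fin 6 → Bool) → Set
AdjacentFalse b = Σ (Fin 6) λ e → Σ (Fin 6) λ e′ →
  e ≢ e′ × b e ≡ false × b e′ ≡ false × ShareVertex e e′

adjacentFalse? : ∀ b → Dec (AdjacentFalse b)
adjacentFalse? b = any? λ e → any? λ e′ →
  ¬? (e ≟ᶠ e′) ×-dec b e ≟ᵇ false ×-dec b e′ ≟ᵇ false ×-dec shareVertex? e e′

abstract
  -- Of three edges of K₄, two share a vertex.
  count≤3⇒adjacentFalse : ∀Values λ b → count b ≤ 3 → AdjacentFalse b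
  count≤3⇒adjacentFalse = from-yes (∀Values? λ b → count b ℕ.≤? 3 →-dec adjacentFalse? b)

  adjacentFalse⇒count≤4 : ∀Values λ b → AdjacentFalse b → count b ≤ 4
  adjacentFalse⇒count≤4 = from-yes (∀Values? λ b → adjacentFalse? b →-dec count b ℕ.≤? 4)

module _ (len : Fin 6 → ℕ) where

  private
    subdivided : Fin 6 → Bool
    subdivided e = 1 ≤ᵇ len e

    false⇒flat : ∀ n → (1 ≤ᵇ n) ≡ false → n ≡ 0
    false⇒flat zero _ = refl

    flat⇒false : ∀ {n} → n ≡ 0 → (1 ≤ᵇ n) ≡ false
    flat⇒false refl = refl

    numSubdivided≡count : numSubdivided len ≡ count (reify subdivided)
    numSubdivided≡count = length-filter-cong (λ e → 1 ℕ.≤? len e) (T? ∘ reify subdivided)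
      (λ e → ≡-sym (reify-≗ subdivided e)) (allFin 6)

  numSubdivided≤3⇒adjacentFlatEdges : numSubdivided len ≤ 3 → AdjacentFlatEdges len
  numSubdivided≤3⇒adjacentFlatEdges ≤3
    with at {λ b → count b ≤ 3 → AdjacentFalse b} count≤3⇒adjacentFalse subdivided
           (subst (_≤ 3) numSubdivided≡count ≤3)
  ... | e , e′ , e≢e′ , p , p′ , share =
    e , e′ , e≢e′ , false⇒flat _ (trans (≡-sym (reify-≗ subdivided e)) p) ,
    false⇒flat _ (trans (≡-sym (reify-≗ subdivided e′)) p′) , share

  adjacentFlatEdges⇒numSubdivided≤4 : AdjacentFlatEdges len → numSubdivided len ≤ 4
  adjacentFlatEdges⇒numSubdivided≤4 (e , e′ , e≢e′ , p , p′ , share) =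
    subst (_≤ 4) (≡-sym numSubdivided≡count)
      (at {λ b → AdjacentFalse b → count b ≤ 4} adjacentFalse⇒count≤4 subdivided
        (e , e′ , e≢e′ , trans (reify-≗ subdivided e) (flat⇒false p) ,
         trans (reify-≗ subdivided e′) (flat⇒false p′) , share))

adjacentFlatEdges? : ∀ len → Dec (AdjacentFlatEdges len)
adjacentFlatEdges? len = any? λ e → any? λ e′ →
  ¬? (e ≟ᶠ e′) ×-dec len e ℕ.≟ 0 ×-dec len e′ ℕ.≟ 0 ×-dec shareVertex? e e′

-- Transfer to an arbitrary subdivision of K₄

module _ {G : Graph} {len : Fin 6 → ℕ} (sub : IsSubdivisionOfK4 G len) where
  open Bijection (proj₁ sub) using (injective; to⁻; strictlySurjective) renaming (to to f⟨_⟩)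

  private
    f-to⁻ : ∀ v → f⟨ to⁻ v ⟩ ≡ v
    f-to⁻ v = proj₂ (strictlySurjective v)

    to⁻-adj : ∀ {u v} → Adj G u v → SubAdj len (to⁻ u) (to⁻ v)
    to⁻-adj u~v = Equivalence.to (proj₂ sub _ _)
      (subst id (cong₂ (Adj G) (≡-sym (f-to⁻ _)) (≡-sym (f-to⁻ _))) u~v)

    f-adj : ∀ {u v} → SubAdj len u v → Adj G f⟨ u ⟩ f⟨ v ⟩
    f-adj = Equivalence.from (proj₂ sub _ _)

  Sub↪ : Sub len ↪ G
  Sub↪ = record
    { to = f⟨_⟩ ; from = to⁻ ; to-adj = f-adj ; from-adj = to⁻-adj
    ; from-to = λ u → injective (f-to⁻ f⟨ u ⟩) }

  ↪Sub : G ↪ Sub len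
  ↪Sub = record
    { to = to⁻ ; from = f⟨_⟩ ; to-adj = to⁻-adj ; from-adj = f-adj ; from-to = f-to⁻ }

theorem4 : (G : Graph) (len : Fin 6 → ℕ) →
    IsSubdivisionOfK4 G len → TriangleFree G →
    (IsRestrictedFrameGraph G ⇔
      (numSubdivided len ≤ 3
       ⊎ (numSubdivided len ≡ 4
          × Σ (Fin 6) λ e → Σ (Fin 6) λ e′ →
              e ≢ e′ × len e ≡ 0 × len e′ ≡ 0 × ShareVertex e e′)))
theorem4 G len sub tf = mk⇔ necessary sufficient
  where
  tf-Sub : TriangleFree (Sub len)
  tf-Sub = TriangleFree-pull {Sub len} {G} (_↪_.to (Sub↪ {G} sub)) (_↪_.to-adj (Sub↪ {G} sub)) tf

  necessary : RestrictedFrameRep G →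
    numSubdivided len ≤ 3 ⊎ (numSubdivided len ≡ 4 × AdjacentFlatEdges len)
  necessary R with adjacentFlatEdges? len
  ... | no ¬flat = contradiction (restrict (Sub↪ sub) R) (matching-not-representable tf-Sub
          λ e≢e′ p p′ share → ¬flat (_ , _ , e≢e′ , p , p′ , share))
  -- Two unsubdivided edges bound the count by 4; the disjunct depends on whether this is attained.
  ... | yes flat with ℕ.m≤n⇒m<n∨m≡n (adjacentFlatEdges⇒numSubdivided≤4 len flat)
  ...   | inj₁ <4 = inj₁ (ℕ.s≤s⁻¹ <4)
  ...   | inj₂ ≡4 = inj₂ (≡4 , flat)

  sufficient : numSubdivided len ≤ 3 ⊎ (numSubdivided len ≡ 4 × AdjacentFlatEdges len) →
    RestrictedFrameRep G
  sufficient = restrict (↪Sub sub) ∘ adjacentFlatEdges⇒representation tf-Sub ∘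
    [ numSubdivided≤3⇒adjacentFlatEdges len , proj₂ ]′
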